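{- Let $(M;c)$ be a connected modular coloured matroid having a line with at least four points. Then $(M;c)$ is a target if and only if $(M|L;\,c|L)$ is a target for each line $L$ of $M$.
   Context: A coloured matroid $(M;c)$ is a (finite) matroid $M$ with a function $c$ on $E(M)$. $M$ is modular if $r_M(F)+r_M(F')=r_M(F\cup F')+r_M(F\cap F')$ for all flats $F,F'$. A point is a rank-one flat, a line a rank-two flat; a line has at least four points if it contains at least four rank-one flats. $(M;c)$ is a target if there are flats $\mathrm{cl}_M(\varnothing)=F_0\subseteq F_1\subseteq\dots\subseteq F_k=E(M)$ such that every nonempty set among $F_0$ and the sets $F_{i+1}-F_i$ is monochromatic under $c$. -}

module Defs where

open import Data.Nat using (ℕ; suc; _+_; _≤_; _<_)
open import Data.Fin using (Fin; zero; fromℕ; inject₁)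
open import Data.Fin.Subset
  using (Subset; _∈_; _∉_; _⊆_; _∪_; _∩_; ∁; ⁅_⁆; ∣_∣; Nonempty)
  renaming (⊤ to Full; ⊥ to Empty)
open import Data.Product using (Σ; ∃; _×_; _,_)
open import Relation.Binary.PropositionalEquality using (_≡_; _≢_)

record Matroid (n : ℕ) : Set where
  field
    r      : Subset n → ℕ
    r-card : ∀ X → r X ≤ ∣ X ∣
    r-mono : ∀ {X Y} → X ⊆ Y → r X ≤ r Y
    r-sub  : ∀ X Y → r (X ∪ Y) + r (X ∩ Y) ≤ r X + r Y
open Matroid public

module _ {n : ℕ} (M : Matroid n) where

  -- F is a flat of the restriction M|S (S ⊆ E): F ⊆ S and adding any
  -- element of S − F strictly increases the rank.
  IsFlatIn : Subset n → Subset n → Set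
  IsFlatIn S F = F ⊆ S × (∀ e → e ∈ S → e ∉ F → r M F < r M (F ∪ ⁅ e ⁆))

  IsFlat : Subset n → Set
  IsFlat = IsFlatIn Full

  -- closure of ∅ in M|S : the loops of M lying in S
  ClEmptyIn : Subset n → Subset n → Set
  ClEmptyIn S X = ∀ e → (e ∈ X → e ∈ S × r M ⁅ e ⁆ ≡ 0)
                      × (e ∈ S → r M ⁅ e ⁆ ≡ 0 → e ∈ X)

  Modular : Set
  Modular = ∀ F F' → IsFlat F → IsFlat F' →
            r M F + r M F' ≡ r M (F ∪ F') + r M (F ∩ F')

  Connected : Set
  Connected = ∀ X → Nonempty X → Nonempty (∁ X) → r M Full < r M X + r M (∁ X)

  IsPoint : Subset n → Set
  IsPoint P = IsFlat P × r M P ≡ 1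

  IsLine : Subset n → Set
  IsLine L = IsFlat L × r M L ≡ 2

  LineWithFourPoints : Subset n → Set
  LineWithFourPoints L =
    IsLine L ×
    ∃ λ P₁ → ∃ λ P₂ → ∃ λ P₃ → ∃ λ P₄ →
      (IsPoint P₁ × P₁ ⊆ L) × (IsPoint P₂ × P₂ ⊆ L) ×
      (IsPoint P₃ × P₃ ⊆ L) × (IsPoint P₄ × P₄ ⊆ L) ×
      P₁ ≢ P₂ × P₁ ≢ P₃ × P₁ ≢ P₄ × P₂ ≢ P₃ × P₂ ≢ P₄ × P₃ ≢ P₄

  Monochromatic : {C : Set} → (Fin n → C) → Subset n → Set
  Monochromatic c X = ∀ x y → x ∈ X → y ∈ X → c x ≡ c y

  -- (M|S ; c|S) is a target: a chain of flats of M|S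
  -- cl_{M|S}(∅) = F₀ ⊆ F₁ ⊆ … ⊆ F_k = S with F₀ and each F_{i+1} − F_i
  -- monochromatic.
  TargetOn : {C : Set} → (Fin n → C) → Subset n → Set
  TargetOn c S =
    ∃ λ k → ∃ λ (F : Fin (suc k) → Subset n) →
      ClEmptyIn S (F zero) ×
      F (fromℕ k) ≡ S ×
      (∀ i → IsFlatIn S (F i)) ×
      (∀ (i : Fin k) → F (inject₁ i) ⊆ F (Fin.suc i)) ×
      Monochromatic c (F zero) ×
      (∀ (i : Fin k) → ∀ x y →
         x ∈ F (Fin.suc i) → x ∉ F (inject₁ i) →
         y ∈ F (Fin.suc i) → y ∉ F (inject₁ i) → c x ≡ c y)

  Target : {C : Set} → (Fin n → C) → Set
  Target c = TargetOn c Full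

{-# OPTIONS --safe #-}
module Submission where

-- Restricting a chain of flats to a line settles one direction.  For the other, a connected
-- modular matroid is, up to parallel elements, a projective geometry in which every line has
-- at least four points, so that no flat is a union of three proper subflats.  It suffices to
-- find in each flat F of rank k ≥ 1 a proper subflat G with F − G monochromatic (F then has a
-- majority colour) and to iterate.  For k ≤ 2 this is the hypothesis on lines.  For k ≥ 3
-- compare the majority colours of flats K ⊂ H ⊂ F of ranks k − 2 and k − 1; if they differ,
-- then K is the set of exceptions of H.
--   * If two hyperplanes H of F deviate from the same K, a generic line through both shows
--     that all hyperplanes through K but one share a colour other than that of K.
--   * If only H deviates from K, the hyperplanes through K and those through another K' ⊂ H
--     have different colours, and too many of their intersections have to be exceptional.
--   * If no pair deviates, all hyperplanes have the same colour a.  Elements of other colours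
--     cannot span a hyperplane, hence do not span F.

open import Defs
open import Data.Nat using (ℕ; zero; suc; _+_; _≤_; _<_; z≤n; s≤s; s≤s⁻¹; _≤?_; _<?_)
open import Data.Nat.Properties as ℕ using (≤-refl; ≤-reflexive; ≤-trans; ≰⇒>; <⇒≱)
open import Data.Nat.Induction using (<-wellFounded)
open import Induction.WellFounded using (Acc; acc)
open import Data.Fin using (Fin; zero; suc; fromℕ; inject₁)
open import Data.Fin.Properties using (any?; all?; pigeonhole; ¬∀⟶∃¬)
open import Data.Fin.Subset
open import Data.Fin.Subset.Properties
open import Data.Vec using (tabulate)
open import Data.Vec.Properties using (lookup∘tabulate; []=⇒lookup; lookup⇒[]=)
open import Data.List using (List; []; _∷_; allFin; cartesianProduct)
open import Data.List.Membership.Propositional using () renaming (_∈_ to _∈ₗ_)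
open import Data.List.Membership.Propositional.Properties using (∈-allFin; ∈-cartesianProduct⁺)
open import Data.List.Relation.Unary.Any using (here; there)
open import Data.Product using (∃; _×_; _,_; proj₁; proj₂)
open import Data.Sum using (_⊎_; inj₁; inj₂)
open import Data.Empty using (⊥-elim) renaming (⊥ to False)
open import Function using (_∘_; id; case_of_)
open import Function.Bundles using (_⇔_; mk⇔)
open import Relation.Nullary using (¬_; Dec; yes; no; does; contradiction)
open import Relation.Nullary.Decidable
  using (dec-true; _×-dec_; _⊎-dec_; _→-dec_; ¬?; decidable-stable; map′)
open import Relation.Unary using (Decidable)
open import Relation.Binary.PropositionalEquality
  using (_≡_; _≢_; refl; sym; trans; cong; cong₂; subst)

-- Subsets and closure

module _ {n : ℕ} where

  ⟦_⟧ : {P : Fin n → Set} → Decidable P → Subset n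
  ⟦ P? ⟧ = tabulate (does ∘ P?)

  ∈⟦⟧⁺ : {P : Fin n → Set} (P? : Decidable P) {x : Fin n} → P x → x ∈ ⟦ P? ⟧
  ∈⟦⟧⁺ P? {x} px = lookup⇒[]= x _ (trans (lookup∘tabulate _ x) (dec-true (P? x) px))

  ∈⟦⟧⁻ : {P : Fin n → Set} (P? : Decidable P) {x : Fin n} → x ∈ ⟦ P? ⟧ → P x
  ∈⟦⟧⁻ P? {x} x∈ with P? x | trans (sym (lookup∘tabulate (does ∘ P?) x)) ([]=⇒lookup x∈)
  ... | yes px | _ = px
  ... | no _ | ()

  infixl 6 _▹_

  _▹_ : Subset n → Fin n → Subset n
  X ▹ e = X ∪ ⁅ e ⁆

  ⊆▹ : ∀ {X e} → X ⊆ X ▹ e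
  ⊆▹ = p⊆p∪q _

  ∈▹ : ∀ {X e} → e ∈ X ▹ e
  ∈▹ {X} {e} = q⊆p∪q X _ (x∈⁅x⁆ e)

  ▹-⊆ : ∀ {X Y e} → X ⊆ Y → e ∈ Y → X ▹ e ⊆ Y
  ▹-⊆ {X} {Y} {e} X⊆Y e∈Y x∈ with x∈p∪q⁻ X ⁅ e ⁆ x∈
  ... | inj₁ x∈X = X⊆Y x∈X
  ... | inj₂ x∈e with refl ← x∈⁅y⁆⇒x≡y e x∈e = e∈Y

  ▹-mono : ∀ {X Y e} → X ⊆ Y → X ▹ e ⊆ Y ▹ e
  ▹-mono X⊆Y = ▹-⊆ (⊆▹ ∘ X⊆Y) ∈▹

  ⁅⁆⊆ : ∀ {X : Subset n} {e} → e ∈ X → ⁅ e ⁆ ⊆ X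
  ⁅⁆⊆ {e = e} e∈X x∈ with refl ← x∈⁅y⁆⇒x≡y e x∈ = e∈X

  ∩⁺ : ∀ {X Y : Subset n} {x} → x ∈ X → x ∈ Y → x ∈ X ∩ Y
  ∩⁺ x∈X x∈Y = x∈p∩q⁺ (x∈X , x∈Y)

  ∩⁻ˡ : ∀ (X Y : Subset n) → X ∩ Y ⊆ X
  ∩⁻ˡ X Y = p∩q⊆p X Y

  ∩⁻ʳ : ∀ (X Y : Subset n) → X ∩ Y ⊆ Y
  ∩⁻ʳ X Y = p∩q⊆q X Y

  ∪-⊆ : ∀ {X Y Z : Subset n} → X ⊆ Z → Y ⊆ Z → X ∪ Y ⊆ Z
  ∪-⊆ {X} {Y} f g x∈ with x∈p∪q⁻ X Y x∈
  ... | inj₁ x∈X = f x∈X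
  ... | inj₂ x∈Y = g x∈Y

  Outside : Subset n → Subset n → Set
  Outside X A = ∃ λ e → e ∈ X × e ∉ A

  opaque
    ⊆-or-outside : ∀ X A → X ⊆ A ⊎ Outside X A
    ⊆-or-outside X A with any? (λ e → (e ∈? X) ×-dec ¬? (e ∈? A))
    ... | yes out = inj₂ out
    ... | no ¬out = inj₁ λ {x} x∈X → case x ∈? A of λ where
      (yes x∈A) → x∈A
      (no x∉A) → ⊥-elim (¬out (x , x∈X , x∉A))

  opaque
    ⊈⇒outside : ∀ {X A} → ¬ (X ⊆ A) → Outside X A
    ⊈⇒outside {X} {A} X⊈A with ⊆-or-outside X A
    ... | inj₁ X⊆A = ⊥-elim (X⊈A X⊆A)
    ... | inj₂ out = out

  subset-induction : (P : Subset n → Set) → P ⊥ →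
                     (∀ Y e → P Y → P (Y ▹ e)) → ∀ Y → P Y
  subset-induction P base step Y = go Y (<-wellFounded ∣ Y ∣)
    where
    go : ∀ Y → Acc _<_ ∣ Y ∣ → P Y
    go Y (acc rs) with nonempty? Y
    ... | no empty = subst P (sym (Empty-unique empty)) base
    ... | yes (e , e∈Y) =
      subst P (⊆-antisym (▹-⊆ (p─q⊆p Y _) e∈Y) split)
        (step (Y - e) e (go (Y - e) (rs (x∈p⇒∣p-x∣<∣p∣ e∈Y))))
      where
      split : Y ⊆ (Y - e) ▹ e
      split {x} x∈Y with x Data.Fin.≟ e
      ... | yes refl = ∈▹
      ... | no x≢e = ⊆▹ (x∈p∧x≢y⇒x∈p-y x∈Y x≢e)

module Closure {n : ℕ} (M : Matroid n) where

  rk : Subset n → ℕ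
  rk = r M

  rk-mono : ∀ {X Y} → X ⊆ Y → rk X ≤ rk Y
  rk-mono = r-mono M

  rk-▹ : ∀ X e → rk (X ▹ e) ≤ suc (rk X)
  rk-▹ X e = begin
    rk (X ▹ e)                     ≤⟨ ℕ.m≤m+n _ _ ⟩
    rk (X ▹ e) + rk (X ∩ ⁅ e ⁆)   ≤⟨ r-sub M X ⁅ e ⁆ ⟩
    rk X + rk ⁅ e ⁆                ≤⟨ ℕ.+-monoʳ-≤ (rk X) (r-card M ⁅ e ⁆) ⟩
    rk X + ∣ ⁅ e ⁆ ∣               ≡⟨ cong (rk X +_) (∣⁅x⁆∣≡1 e) ⟩
    rk X + 1                       ≡⟨ ℕ.+-comm (rk X) 1 ⟩
    suc (rk X)                     ∎
    where open ℕ.≤-Reasoning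

  rk-⊥ : rk ⊥ ≡ 0
  rk-⊥ = ℕ.n≤0⇒n≡0 (subst (rk ⊥ ≤_) (∣⊥∣≡0 n) (r-card M ⊥))

  -- Submodularity for `X ▹ e` and `Y`: their union contains `Y ▹ e` and their intersection contains
  -- `X`.
  spanned-mono : ∀ {X Y e} → X ⊆ Y → rk (X ▹ e) ≤ rk X → rk (Y ▹ e) ≤ rk Y
  spanned-mono {X} {Y} {e} X⊆Y Xe≤X = ℕ.+-cancelʳ-≤ (rk X) _ _ (begin
    rk (Y ▹ e) + rk X                          ≤⟨ ℕ.+-mono-≤ (rk-mono Ye⊆) (rk-mono X⊆) ⟩
    rk ((X ▹ e) ∪ Y) + rk ((X ▹ e) ∩ Y)        ≤⟨ r-sub M (X ▹ e) Y ⟩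
    rk (X ▹ e) + rk Y                          ≤⟨ ℕ.+-monoˡ-≤ (rk Y) Xe≤X ⟩
    rk X + rk Y                                ≡⟨ ℕ.+-comm (rk X) (rk Y) ⟩
    rk Y + rk X                                ∎)
    where
    open ℕ.≤-Reasoning
    Ye⊆ : Y ▹ e ⊆ (X ▹ e) ∪ Y
    Ye⊆ = ▹-⊆ (q⊆p∪q (X ▹ e) Y) (p⊆p∪q Y (∈▹ {X = X}))
    X⊆ : X ⊆ (X ▹ e) ∩ Y
    X⊆ x∈X = ∩⁺ (⊆▹ x∈X) (X⊆Y x∈X)

  spanned? : ∀ X → Decidable (λ e → rk (X ▹ e) ≤ rk X)
  spanned? X e = rk (X ▹ e) ≤? rk X

  opaque
    cl : Subset n → Subset n
    cl X = ⟦ spanned? X ⟧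

    ∈cl⁺ : ∀ {X e} → rk (X ▹ e) ≤ rk X → e ∈ cl X
    ∈cl⁺ {X} = ∈⟦⟧⁺ (spanned? X)

    ∈cl⁻ : ∀ {X e} → e ∈ cl X → rk (X ▹ e) ≤ rk X
    ∈cl⁻ {X} = ∈⟦⟧⁻ (spanned? X)

  ∉cl⇒< : ∀ {X e} → e ∉ cl X → rk X < rk (X ▹ e)
  ∉cl⇒< e∉ = ≰⇒> (e∉ ∘ ∈cl⁺)

  rk-∉cl : ∀ {X e} → e ∉ cl X → rk (X ▹ e) ≡ suc (rk X)
  rk-∉cl {X} {e} e∉ = ℕ.≤-antisym (rk-▹ X e) (∉cl⇒< e∉)

  ⊆cl : ∀ {X} → X ⊆ cl X
  ⊆cl x∈X = ∈cl⁺ (rk-mono (▹-⊆ id x∈X))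

  cl-mono : ∀ {X Y} → X ⊆ Y → cl X ⊆ cl Y
  cl-mono X⊆Y = ∈cl⁺ ∘ spanned-mono X⊆Y ∘ ∈cl⁻

  -- By `spanned-mono`, adding the elements of `cl X` to `X` one at a time never raises the rank.
  rk-cl : ∀ X → rk (cl X) ≡ rk X
  rk-cl X = ℕ.≤-antisym
    (≤-trans (rk-mono (q⊆p∪q X (cl X))) (subset-induction P base step (cl X) id))
    (rk-mono ⊆cl)
    where
    P : Subset n → Set
    P Y = Y ⊆ cl X → rk (X ∪ Y) ≤ rk X
    base : P ⊥
    base _ = rk-mono (∪-⊆ id (⊥-elim ∘ ∉⊥))
    step : ∀ Y e → P Y → P (Y ▹ e)
    step Y e ih Ye⊆ = begin
      rk (X ∪ (Y ▹ e))   ≡⟨ cong rk (sym (∪-assoc X Y ⁅ e ⁆)) ⟩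
      rk ((X ∪ Y) ▹ e)   ≤⟨ spanned-mono (p⊆p∪q Y) (∈cl⁻ (Ye⊆ (∈▹ {X = Y}))) ⟩
      rk (X ∪ Y)         ≤⟨ ih (Ye⊆ ∘ ⊆▹) ⟩
      rk X               ∎
      where open ℕ.≤-Reasoning

  Closed : Subset n → Set
  Closed F = cl F ⊆ F

  cl-closed : ∀ {X} → Closed (cl X)
  cl-closed {X} {e} e∈ = ∈cl⁺ (begin
    rk (X ▹ e)     ≤⟨ rk-mono (▹-mono ⊆cl) ⟩
    rk (cl X ▹ e)  ≤⟨ ∈cl⁻ e∈ ⟩
    rk (cl X)      ≡⟨ rk-cl X ⟩
    rk X           ∎)
    where open ℕ.≤-Reasoning

  cl-least : ∀ {X F} → Closed F → X ⊆ F → cl X ⊆ F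
  cl-least F-closed X⊆F = F-closed ∘ cl-mono X⊆F

  ∩-closed : ∀ {A B} → Closed A → Closed B → Closed (A ∩ B)
  ∩-closed {A} {B} A-closed B-closed e∈ =
    ∩⁺ (A-closed (cl-mono (∩⁻ˡ A B) e∈)) (B-closed (cl-mono (∩⁻ʳ A B) e∈))

  closed-rk-⊆ : ∀ {X Y} → Closed X → X ⊆ Y → rk Y ≤ rk X → Y ⊆ X
  closed-rk-⊆ X-closed X⊆Y Y≤X e∈Y = X-closed (∈cl⁺ (≤-trans (rk-mono (▹-⊆ X⊆Y e∈Y)) Y≤X))

  exchange : ∀ {X x y} → y ∈ cl (X ▹ x) → y ∉ cl X → x ∈ cl (X ▹ y)
  exchange {X} {x} {y} y∈ y∉ = ∈cl⁺ (begin
    rk ((X ▹ y) ▹ x)  ≤⟨ rk-mono (▹-⊆ (▹-mono ⊆▹) (⊆▹ ∈▹)) ⟩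
    rk ((X ▹ x) ▹ y)  ≤⟨ ∈cl⁻ y∈ ⟩
    rk (X ▹ x)        ≤⟨ rk-▹ X x ⟩
    suc (rk X)        ≤⟨ ∉cl⇒< y∉ ⟩
    rk (X ▹ y)        ∎)
    where open ℕ.≤-Reasoning

  opaque
    rk-<⇒outside : ∀ {A X} → rk A < rk X → Outside X A
    rk-<⇒outside A<X = ⊈⇒outside λ X⊆A → <⇒≱ A<X (rk-mono X⊆A)

  opaque
    rk->0⇒nonempty : ∀ {X} → 0 < rk X → Nonempty X
    rk->0⇒nonempty {X} 0<X with nonempty? X
    ... | yes ne = ne
    ... | no empty with refl ← Empty-unique empty = contradiction rk-⊥ (ℕ.>⇒≢ 0<X)

  flat⇒closed : ∀ {F} → IsFlat M F → Closed F
  flat⇒closed {F} (_ , grow) {e} e∈ with e ∈? F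
  ... | yes e∈F = e∈F
  ... | no e∉F = ⊥-elim (<⇒≱ (grow e ∈⊤ e∉F) (∈cl⁻ e∈))

  closed⇒flat : ∀ {F} → Closed F → IsFlat M F
  closed⇒flat F-closed = ⊆⊤ , λ e _ e∉F → ∉cl⇒< (e∉F ∘ F-closed)

  opaque
    -- A discrete intermediate value argument: the rank grows by at most one with each element of
    -- `Y` that is added to `X`. The set `Z` need not be a flat; callers pass to its closure, which
    -- has the same rank.
    intermediate : ∀ {X Y j} → X ⊆ Y → rk X ≤ j → j ≤ rk Y →
                   ∃ λ Z → X ⊆ Z × Z ⊆ Y × rk Z ≡ j
    intermediate {X} {Y} {j} X⊆Y X≤j j≤Y =
      subset-induction P base step Y id (≤-trans j≤Y (rk-mono (q⊆p∪q X Y)))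
      where
      P : Subset n → Set
      P W = W ⊆ Y → j ≤ rk (X ∪ W) → ∃ λ Z → X ⊆ Z × Z ⊆ Y × rk Z ≡ j
      base : P ⊥
      base _ j≤ = X , id , X⊆Y ,
        ℕ.≤-antisym X≤j (≤-trans j≤ (rk-mono (∪-⊆ id (⊥-elim ∘ ∉⊥))))
      step : ∀ W e → P W → P (W ▹ e)
      step W e ih We⊆ j≤ with j ≤? rk (X ∪ W)
      ... | yes j≤W = ih (We⊆ ∘ ⊆▹) j≤W
      ... | no j≰W = X ∪ (W ▹ e) , p⊆p∪q _ , ∪-⊆ X⊆Y We⊆ , ℕ.≤-antisym le j≤
        where
        open ℕ.≤-Reasoning
        le : rk (X ∪ (W ▹ e)) ≤ j
        le = begin
          rk (X ∪ (W ▹ e))   ≡⟨ cong rk (sym (∪-assoc X W ⁅ e ⁆)) ⟩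
          rk ((X ∪ W) ▹ e)   ≤⟨ rk-▹ _ e ⟩
          suc (rk (X ∪ W))   ≤⟨ ≰⇒> j≰W ⟩
          j                  ∎

-- Lines in connected modular matroids

module Lines {n : ℕ} (M : Matroid n) (loopless : ∀ e → 1 ≤ r M ⁅ e ⁆) where

  open Closure M public

  rk-⁅⁆ : ∀ e → rk ⁅ e ⁆ ≡ 1
  rk-⁅⁆ e = ℕ.≤-antisym (subst (rk ⁅ e ⁆ ≤_) (∣⁅x⁆∣≡1 e) (r-card M ⁅ e ⁆)) (loopless e)

  -- As there are no loops, this is the parallel class of `x`. Throughout, `y ∉ pt x` expresses that
  -- `x` and `y` represent different points.
  pt : Fin n → Subset n
  pt x = cl ⁅ x ⁆

  ∈pt : ∀ {x} → x ∈ pt x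
  ∈pt {x} = ⊆cl (x∈⁅x⁆ x)

  pt-⊆ : ∀ {F x} → Closed F → x ∈ F → pt x ⊆ F
  pt-⊆ F-closed x∈F = cl-least F-closed (⁅⁆⊆ x∈F)

  rk-pt : ∀ x → rk (pt x) ≡ 1
  rk-pt x = trans (rk-cl ⁅ x ⁆) (rk-⁅⁆ x)

  pt-sym : ∀ {x y} → y ∈ pt x → x ∈ pt y
  pt-sym {x} {y} y∈ = closed-rk-⊆ cl-closed (pt-⊆ cl-closed y∈)
    (≤-reflexive (trans (rk-pt x) (sym (rk-pt y)))) ∈pt

  line : Fin n → Fin n → Subset n
  line x y = cl (⁅ x ⁆ ▹ y)

  ∈lineˡ : ∀ {x y} → x ∈ line x y
  ∈lineˡ {x} = ⊆cl (⊆▹ (x∈⁅x⁆ x))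

  ∈lineʳ : ∀ {x y} → y ∈ line x y
  ∈lineʳ {x} = ⊆cl (∈▹ {X = ⁅ x ⁆})

  line-⊆ : ∀ {F x y} → Closed F → x ∈ F → y ∈ F → line x y ⊆ F
  line-⊆ F-closed x∈F y∈F = cl-least F-closed (▹-⊆ (⁅⁆⊆ x∈F) y∈F)

  line-comm : ∀ {x y} → line x y ⊆ line y x
  line-comm = line-⊆ cl-closed ∈lineʳ ∈lineˡ

  rk-line : ∀ {x y} → y ∉ pt x → rk (line x y) ≡ 2
  rk-line {x} {y} y∉ = trans (rk-cl _) (trans (rk-∉cl y∉) (cong suc (rk-⁅⁆ x)))

  line-exchange : ∀ {x y s} → s ∈ line x y → s ∉ pt x → y ∈ line x s
  line-exchange = exchange

  line-extend : ∀ {F x y s} → Closed F → x ∈ F → s ∈ F → s ∈ line x y → s ∉ pt x → y ∈ F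
  line-extend F-closed x∈F s∈F s∈ s∉ = line-⊆ F-closed x∈F s∈F (line-exchange s∈ s∉)

  ⊆line : ∀ {L x y} → rk L ≡ 2 → Closed L → x ∈ L → y ∈ L → y ∉ pt x → L ⊆ line x y
  ⊆line L≡2 L-closed x∈L y∈L y∉ = closed-rk-⊆ cl-closed (line-⊆ L-closed x∈L y∈L)
    (≤-reflexive (trans L≡2 (sym (rk-line y∉))))

module ModularGeometry {n : ℕ} (M : Matroid n) (loopless : ∀ e → 1 ≤ r M ⁅ e ⁆)
                       (modular : Modular M) where

  open Lines M loopless public

  -- The lower bound that modularity gives for the rank of an intersection; `F` stands in for the
  -- union, whose exact rank is rarely known.
  rk-∩ : ∀ {A B F} → Closed A → Closed B → A ⊆ F → B ⊆ F →
         rk A + rk B ≤ rk F + rk (A ∩ B)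
  rk-∩ {A} {B} {F} A-closed B-closed A⊆F B⊆F = begin
    rk A + rk B              ≡⟨ modular A B (closed⇒flat A-closed) (closed⇒flat B-closed) ⟩
    rk (A ∪ B) + rk (A ∩ B)  ≤⟨ ℕ.+-monoˡ-≤ _ (rk-mono (∪-⊆ A⊆F B⊆F)) ⟩
    rk F + rk (A ∩ B)        ∎
    where open ℕ.≤-Reasoning

  opaque
    -- In `cl (F ▹ f)`, which contains the line through `e` and `f`, the flat `F` has corank at most
    -- one. Hence modularity gives the two a common point, as in a projective geometry.
    line-meets : ∀ {F e f} → Closed F → e ∈ cl (F ▹ f) → f ∉ pt e →
                 ∃ λ g → g ∈ F × g ∈ line e f
    line-meets {F} {e} {f} F-closed e∈ f∉ =
      let g , g∈ = rk->0⇒nonempty 1≤ in g , ∩⁻ˡ F _ g∈ , ∩⁻ʳ F _ g∈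
      where
      open ℕ.≤-Reasoning
      1≤ : 1 ≤ rk (F ∩ line e f)
      1≤ = ℕ.+-cancelˡ-≤ (suc (rk F)) _ _ (begin
        suc (rk F) + 1                        ≡⟨ sym (ℕ.+-suc (rk F) 1) ⟩
        rk F + 2                              ≡⟨ cong (rk F +_) (sym (rk-line f∉)) ⟩
        rk F + rk (line e f)                  ≤⟨ rk-∩ F-closed cl-closed (⊆cl ∘ ⊆▹)
                                                   (line-⊆ cl-closed e∈ (⊆cl (∈▹ {X = F}))) ⟩
        rk (cl (F ▹ f)) + rk (F ∩ line e f)   ≡⟨ cong (_+ rk (F ∩ line e f)) (rk-cl _) ⟩
        rk (F ▹ f) + rk (F ∩ line e f)        ≤⟨ ℕ.+-monoˡ-≤ _ (rk-▹ F f) ⟩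
        suc (rk F) + rk (F ∩ line e f)        ∎)

  Third : Fin n → Fin n → Set
  Third x y = ∃ λ s → s ∈ line x y × s ∉ pt x × s ∉ pt y

  -- Perspectivity of points. The lemmas below make it transitive, so that its classes can be
  -- compared with the components of `M`.
  Linked : Fin n → Fin n → Set
  Linked x y = y ∈ pt x ⊎ Third x y

  opaque
    linked? : ∀ x → Decidable (Linked x)
    linked? x y = (y ∈? pt x) ⊎-dec
      any? (λ s → (s ∈? line x y) ×-dec ¬? (s ∈? pt x) ×-dec ¬? (s ∈? pt y))

  linked-pt : ∀ {x f e} → e ∈ pt f → Linked x f → Linked x e
  linked-pt e∈f (inj₁ f∈x) = inj₁ (pt-⊆ cl-closed f∈x e∈f)
  linked-pt e∈f (inj₂ (s , s∈ , s∉x , s∉f)) = inj₂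
    (s , line-⊆ cl-closed ∈lineˡ (pt-⊆ cl-closed ∈lineʳ (pt-sym e∈f)) s∈ , s∉x ,
     s∉f ∘ pt-⊆ cl-closed e∈f)

  -- In the main case `x`, `f`, `e` are not collinear. With `p` a third point on `xf` and `g` one on
  -- `fe`, the line `pg` meets `ex` in a point `s`, as in the axiom of Pasch. If `s` were `x` or
  -- `e`, then `x`, `f`, `e` would be collinear.
  linked-line : ∀ {x f e} → Third f e → Linked x f → Linked x e
  linked-line {x} {f} {e} (g , g∈ , g∉f , g∉e) x~f with e ∈? pt x | f ∈? pt x | f ∈? line x e | x~f
  ... | yes e∈x | _ | _ | _ = inj₁ e∈x
  ... | no e∉x | yes f∈x | _ | _ = inj₂
    (g , line-⊆ cl-closed (pt-⊆ cl-closed ∈lineˡ f∈x) ∈lineʳ g∈ ,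
     g∉f ∘ pt-⊆ cl-closed (pt-sym f∈x) , g∉e)
  ... | no e∉x | no f∉x | yes f∈xe | _ = inj₂
    (f , f∈xe , f∉x , λ f∈e → g∉f (line-⊆ cl-closed ∈pt (pt-sym f∈e) g∈))
  ... | no e∉x | no f∉x | no f∉xe | inj₁ f∈x = ⊥-elim (f∉x f∈x)
  ... | no e∉x | no f∉x | no f∉xe | inj₂ (p , p∈ , p∉x , p∉f) =
    inj₂ (s , line-comm s∈ex , s∉x , s∉e)
    where
    -- The span of `p`, `g` and `x` contains `f` and hence `e`, so `line-meets` applies to `pg` and
    -- `ex`.
    f∈Fx : f ∈ cl (line p g ▹ x)
    f∈Fx = line-extend cl-closed (⊆cl (∈▹ {X = line p g})) (⊆cl (⊆▹ ∈lineˡ)) p∈ p∉x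
    e∈Fx : e ∈ cl (line p g ▹ x)
    e∈Fx = line-extend cl-closed f∈Fx (⊆cl (⊆▹ ∈lineʳ)) g∈ g∉f
    met : ∃ λ s → s ∈ line p g × s ∈ line e x
    met = line-meets cl-closed e∈Fx (e∉x ∘ pt-sym)
    s = proj₁ met
    s∈pg = proj₁ (proj₂ met)
    s∈ex = proj₂ (proj₂ met)
    s∉x : s ∉ pt x
    s∉x s∈x = f∉xe (line-exchange e∈xf e∉x)
      where
      x∈pg : x ∈ line p g
      x∈pg = pt-⊆ cl-closed s∈pg (pt-sym s∈x)
      g∈xf : g ∈ line x f
      g∈xf = line-extend cl-closed p∈ ∈lineˡ x∈pg (p∉x ∘ pt-sym)
      e∈xf : e ∈ line x f
      e∈xf = line-extend cl-closed ∈lineʳ g∈xf g∈ g∉f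
    s∉e : s ∉ pt e
    s∉e s∈e = f∉xe (line-comm (line-exchange x∈ef (e∉x ∘ pt-sym)))
      where
      e∈pg : e ∈ line p g
      e∈pg = pt-⊆ cl-closed s∈pg (pt-sym s∈e)
      p∈ef : p ∈ line e f
      p∈ef = line-extend cl-closed (line-comm g∈) ∈lineˡ (line-comm e∈pg) (g∉e ∘ pt-sym)
      x∈ef : x ∈ line e f
      x∈ef = line-extend cl-closed ∈lineʳ p∈ef (line-comm p∈) p∉f

  third-sym : ∀ {x y} → Third x y → Third y x
  third-sym (s , s∈ , s∉x , s∉y) = s , line-comm s∈ , s∉y , s∉x

  -- If `e` is spanned by `Y` and `f`, but neither by `Y` nor by `f` alone, then the line `ef` meets
  -- `cl Y` in a point other than `e` and `f`. This third point links `e` to `f`.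
  third-closed : ∀ S → (∀ {e f} → f ∈ S → e ∈ pt f → e ∈ S) →
                 (∀ {e f} → f ∈ S → Third f e → e ∈ S) → Closed S
  third-closed S pt-stable third-stable = subset-induction P base step S id
    where
    P : Subset n → Set
    P Y = Y ⊆ S → cl Y ⊆ S
    base : P ⊥
    base _ {e} e∈ = contradiction (loopless e) (<⇒≱ (s≤s (begin
      rk ⁅ e ⁆       ≤⟨ rk-mono (q⊆p∪q ⊥ ⁅ e ⁆) ⟩
      rk (⊥ ▹ e)     ≤⟨ ∈cl⁻ e∈ ⟩
      rk ⊥           ≡⟨ rk-⊥ ⟩
      0              ∎)))
      where open ℕ.≤-Reasoning
    step : ∀ Y f → P Y → P (Y ▹ f)
    step Y f ih Yf⊆S {e} e∈ with e ∈? cl Y | e ∈? pt f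
    ... | yes e∈Y | _ = ih (Yf⊆S ∘ ⊆▹) e∈Y
    ... | no e∉Y | yes e∈f = pt-stable (Yf⊆S (∈▹ {X = Y})) e∈f
    ... | no e∉Y | no e∉f
      with g , g∈Y , g∈ef ← line-meets {cl Y} cl-closed (cl-mono (▹-mono ⊆cl) e∈) (e∉f ∘ pt-sym)
      = third-stable (Yf⊆S (∈▹ {X = Y})) (g , line-comm g∈ef , g∉f , g∉e)
      where
      g∉f : g ∉ pt f
      g∉f g∈f = e∉Y (cl-closed (cl-mono (▹-⊆ ⊆cl (pt-⊆ cl-closed g∈Y (pt-sym g∈f))) e∈))
      g∉e : g ∉ pt e
      g∉e g∈e = e∉Y (pt-⊆ cl-closed g∈Y (pt-sym g∈e))

  -- The elements linked to x form a flat, and so do the others; by modularity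
  -- the two are separated unless one of them is empty.
  opaque
    connected⇒linked : Connected M → ∀ x y → Linked x y
    connected⇒linked connected x y = decidable-stable (linked? x y) λ x≁y →
      <⇒≱ (connected A (x , ∈⟦⟧⁺ (linked? x) (inj₁ ∈pt))
                       (y , x∉p⇒x∈∁p (x≁y ∘ ∈⟦⟧⁻ (linked? x)))) separated
      where
      A : Subset n
      A = ⟦ linked? x ⟧
      A-closed : Closed A
      A-closed = third-closed A
        (λ f∈A e∈f → ∈⟦⟧⁺ (linked? x) (linked-pt e∈f (∈⟦⟧⁻ (linked? x) f∈A)))
        (λ f∈A t → ∈⟦⟧⁺ (linked? x) (linked-line t (∈⟦⟧⁻ (linked? x) f∈A)))
      ∁A-closed : Closed (∁ A)
      ∁A-closed = third-closed (∁ A)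
        (λ f∉A e∈f → x∉p⇒x∈∁p λ e∈A → x∈∁p⇒x∉p f∉A
          (∈⟦⟧⁺ (linked? x) (linked-pt (pt-sym e∈f) (∈⟦⟧⁻ (linked? x) e∈A))))
        (λ f∉A t → x∉p⇒x∈∁p λ e∈A → x∈∁p⇒x∉p f∉A
          (∈⟦⟧⁺ (linked? x) (linked-line (third-sym t) (∈⟦⟧⁻ (linked? x) e∈A))))
      A∩∁A⊆⊥ : A ∩ ∁ A ⊆ ⊥
      A∩∁A⊆⊥ e∈ = ⊥-elim (x∈∁p⇒x∉p (∩⁻ʳ A _ e∈) (∩⁻ˡ A _ e∈))
      separated : rk A + rk (∁ A) ≤ rk ⊤
      separated = begin
        rk A + rk (∁ A)       ≤⟨ rk-∩ A-closed ∁A-closed ⊆⊤ ⊆⊤ ⟩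
        rk ⊤ + rk (A ∩ ∁ A)   ≤⟨ ℕ.+-monoʳ-≤ (rk ⊤) (≤-trans (rk-mono A∩∁A⊆⊥) (≤-reflexive rk-⊥)) ⟩
        rk ⊤ + 0              ≡⟨ ℕ.+-identityʳ (rk ⊤) ⟩
        rk ⊤                  ∎
        where open ℕ.≤-Reasoning

  -- For a line this amounts to having at least four points. Stated with covering flats, it passes
  -- easily from one line to another and then from lines to all flats.
  Thick : Subset n → Set
  Thick X = (A : Fin 3 → Subset n) → (∀ i → Closed (A i)) → (∀ i → Outside X (A i)) →
            ∃ λ e → e ∈ X × (∀ i → e ∉ A i)

  -- If the three flats covered all four points, one of them would contain two of the points and
  -- hence the line.
  four-points⇒thick : ∀ {L} → Closed L → rk L ≡ 2 → (p : Fin 4 → Fin n) → (∀ i → p i ∈ L) →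
                      (∀ i j → i Data.Fin.< j → p j ∉ pt (p i)) → Thick L
  four-points⇒thick {L} L-closed L≡2 p p∈L p-distinct A A-closed L⊈A
    with any? (λ j → all? (λ i → ¬? (p j ∈? A i)))
  ... | yes (j , p∉A) = p j , p∈L j , p∉A
  ... | no covered =
    let i , j , i<j , same = pigeonhole ≤-refl (proj₁ ∘ p-in-A)
        e , e∈L , e∉A = L⊈A (proj₁ (p-in-A i))
    in ⊥-elim (e∉A (line-⊆ (A-closed _) (proj₂ (p-in-A i))
         (subst (λ k → p j ∈ A k) (sym same) (proj₂ (p-in-A j)))
         (⊆line L≡2 L-closed (p∈L i) (p∈L j) (p-distinct i j i<j) e∈L)))
    where
    p-in-A : ∀ j → ∃ λ i → p j ∈ A i
    p-in-A j with i , ¬∉ ← ¬∀⟶∃¬ 3 (λ i → p j ∉ A i) (λ i → ¬? (p j ∈? A i)) (covered ∘ (j ,_))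
      = i , decidable-stable (p j ∈? A i) ¬∉

  opaque
    -- Projection from the centre `s`. Each `A i` is replaced by the cone `B i` over its trace on
    -- `L'`; a cone containing `L` would equal `L` by rank and put `s` on `L`. A point of `L` off
    -- the cones projects to a point of `L'` off the `A i`.
    thick-perspective : ∀ {L L' s} → Closed L → rk L ≡ 2 → Closed L' → rk L' ≡ 2 →
                        s ∉ L → s ∉ L' → L ⊆ cl (L' ▹ s) → Thick L → Thick L'
    thick-perspective {L} {L'} {s} L-closed L≡2 L'-closed L'≡2 s∉L s∉L' L⊆ thick A A-closed L'⊈A =
      project (thick B (λ i → cl-closed) (λ i → ⊈⇒outside (L⊈B i)))
      where
      B : Fin 3 → Subset n
      B i = cl ((A i ∩ L') ▹ s)
      L⊈B : ∀ i → ¬ (L ⊆ B i)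
      L⊈B i L⊆B = s∉L (closed-rk-⊆ L-closed L⊆B (begin
        rk (B i)                ≡⟨ rk-cl _ ⟩
        rk ((A i ∩ L') ▹ s)     ≤⟨ rk-▹ _ s ⟩
        suc (rk (A i ∩ L'))     ≤⟨ ≰⇒> L'≰ ⟩
        rk L'                   ≡⟨ trans L'≡2 (sym L≡2) ⟩
        rk L                    ∎) (⊆cl (∈▹ {X = A i ∩ L'})))
        where
        open ℕ.≤-Reasoning
        L'≰ : ¬ (rk L' ≤ rk (A i ∩ L'))
        L'≰ L'≤ with e , e∈L' , e∉A ← L'⊈A i =
          e∉A (∩⁻ˡ (A i) L' (closed-rk-⊆ (∩-closed (A-closed i) L'-closed) (∩⁻ʳ (A i) L') L'≤ e∈L'))
      project : ∃ (λ e → e ∈ L × (∀ i → e ∉ B i)) → ∃ λ e → e ∈ L' × (∀ i → e ∉ A i)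
      project (e , e∈L , e∉B)
        with g , g∈L' , g∈es ← line-meets L'-closed (L⊆ e∈L) (λ s∈e → s∉L (pt-⊆ L-closed e∈L s∈e))
        = g , g∈L' , λ i g∈A → e∉B i (line-extend cl-closed (⊆cl (∈▹ {X = A i ∩ L'}))
            (⊆cl (⊆▹ (∩⁺ g∈A g∈L'))) (line-comm g∈es) (λ g∈s → s∉L' (pt-⊆ L'-closed g∈L' (pt-sym g∈s))))

module ThickGeometry {n : ℕ} (M : Matroid n) (loopless : ∀ e → 1 ≤ r M ⁅ e ⁆)
                     (modular : Modular M) (connected : Connected M) where

  open ModularGeometry M loopless modular public

  opaque
    -- By connectedness, the line through `a` on `L` and some `b` on `L'` has a third point. It
    -- serves as the centre of a perspectivity.
    thick-meeting : ∀ {L L' x a} → Closed L → rk L ≡ 2 → Closed L' → rk L' ≡ 2 →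
                    x ∈ L → x ∈ L' → a ∈ L → a ∉ L' → Thick L → Thick L'
    thick-meeting {L} {L'} {x} {a} L-closed L≡2 L'-closed L'≡2 x∈L x∈L' a∈L a∉L'
      with ⊆-or-outside L' L
    ... | inj₁ L'⊆L =
      ⊥-elim (a∉L' (closed-rk-⊆ L'-closed L'⊆L (≤-reflexive (trans L≡2 (sym L'≡2))) a∈L))
    ... | inj₂ (b , b∈L' , b∉L) with connected⇒linked connected a b
    ... | inj₁ b∈a = ⊥-elim (b∉L (pt-⊆ L-closed a∈L b∈a))
    ... | inj₂ (s , s∈ab , s∉a , s∉b) =
      thick-perspective L-closed L≡2 L'-closed L'≡2
        (λ s∈L → b∉L (line-extend L-closed a∈L s∈L s∈ab s∉a))
        (λ s∈L' → a∉L' (line-extend L'-closed b∈L' s∈L' (line-comm s∈ab) s∉b))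
        (line-⊆ cl-closed (⊆cl (⊆▹ x∈L'))
          (line-extend cl-closed (⊆cl (⊆▹ b∈L')) (⊆cl (∈▹ {X = L'})) (line-comm s∈ab) s∉b)
         ∘ ⊆line L≡2 L-closed x∈L a∈L (λ a∈x → a∉L' (pt-⊆ L'-closed x∈L' a∈x)))

  opaque
    -- Two lines that do not meet are handled through a line `N` joining a point of one to a point
    -- of the other, by using `thick-meeting` twice.
    thick-lines : ∀ {L₀} → Closed L₀ → rk L₀ ≡ 2 → Thick L₀ →
                  ∀ {L} → Closed L → rk L ≡ 2 → Thick L
    thick-lines {L₀} L₀-closed L₀≡2 thick₀ {L} L-closed L≡2 with ⊆-or-outside L₀ L
    ... | inj₁ L₀⊆L = subst Thick (⊆-antisym L₀⊆L
      (closed-rk-⊆ L₀-closed L₀⊆L (≤-reflexive (trans L≡2 (sym L₀≡2))))) thick₀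
    ... | inj₂ (a , a∈L₀ , a∉L) with ⊆-or-outside L L₀
    ... | inj₁ L⊆L₀ =
      ⊥-elim (a∉L (closed-rk-⊆ L-closed L⊆L₀ (≤-reflexive (trans L₀≡2 (sym L≡2))) a∈L₀))
    ... | inj₂ (b , b∈L , b∉L₀) = thick-meeting cl-closed N≡2 L-closed L≡2 ∈lineʳ b∈L ∈lineˡ a∉L thickN
      where
      N≡2 : rk (line a b) ≡ 2
      N≡2 = rk-line (λ b∈a → b∉L₀ (pt-⊆ L₀-closed a∈L₀ b∈a))
      L₀⊈N : ¬ (L₀ ⊆ line a b)
      L₀⊈N L₀⊆N = b∉L₀ (closed-rk-⊆ L₀-closed L₀⊆N (≤-reflexive (trans N≡2 (sym L₀≡2))) ∈lineʳ)
      thickN : Thick (line a b)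
      thickN with c , c∈L₀ , c∉N ← ⊈⇒outside L₀⊈N =
        thick-meeting L₀-closed L₀≡2 cl-closed N≡2 a∈L₀ ∈lineˡ c∈L₀ c∉N thick₀

-- Flats are not unions of three proper subflats

module ThickLines {n : ℕ} (M : Matroid n) (loopless : ∀ e → 1 ≤ r M ⁅ e ⁆)
                  (modular : Modular M)
                  (line-thick : ∀ {L} → Lines.Closed M loopless L → r M L ≡ 2 →
                                ModularGeometry.Thick M loopless modular L) where

  open ModularGeometry M loopless modular public

  opaque
    avoid-on-line : ∀ {F x y} (A : Fin 3 → Subset n) → Closed F → x ∈ F → y ∈ F →
                    (∀ i → Closed (A i)) → (∀ i → x ∉ A i ⊎ y ∉ A i) →
                    ∃ λ e → e ∈ F × (∀ i → e ∉ A i)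
    avoid-on-line {F} {x} {y} A F-closed x∈F y∈F A-closed out with y ∈? pt x
    ... | yes y∈x = x , x∈F , λ i x∈A → case out i of λ where
      (inj₁ x∉A) → x∉A x∈A
      (inj₂ y∉A) → y∉A (pt-⊆ (A-closed i) x∈A y∈x)
    ... | no y∉x with line-thick cl-closed (rk-line y∉x) A A-closed
                        (λ i → case out i of λ where
                          (inj₁ x∉A) → x , ∈lineˡ , x∉A
                          (inj₂ y∉A) → y , ∈lineʳ , y∉A)
    ... | e , e∈ , e∉ = e , line-⊆ F-closed x∈F y∈F e∈ , e∉

  opaque
    -- First find `u` off `A` and `B` on the line `xy`, then `e` off all three on the line `uz`.
    -- Each time every flat misses one of the two elements that span the line.
    avoid : ∀ {F A B C} → Closed F → Closed A → Closed B → Closed C →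
            Outside F A → Outside F B → Outside F C →
            ∃ λ e → e ∈ F × e ∉ A × e ∉ B × e ∉ C
    avoid {F} {A} {B} {C} F-closed A-closed B-closed C-closed
          (x , x∈F , x∉A) (y , y∈F , y∉B) (z , z∈F , z∉C)
      with avoid-on-line (λ { zero → A ; (suc _) → B }) F-closed x∈F y∈F
             (λ { zero → A-closed ; (suc _) → B-closed })
             (λ { zero → inj₁ x∉A ; (suc _) → inj₂ y∉B })
    ... | u , u∈F , u∉AB
      with avoid-on-line (λ { zero → A ; (suc zero) → B ; (suc (suc _)) → C }) F-closed u∈F z∈F
             (λ { zero → A-closed ; (suc zero) → B-closed ; (suc (suc _)) → C-closed })
             (λ { zero → inj₁ (u∉AB zero) ; (suc zero) → inj₁ (u∉AB (suc zero))
                ; (suc (suc _)) → inj₂ z∉C })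
    ... | e , e∈F , e∉ABC = e , e∈F , e∉ABC zero , e∉ABC (suc zero) , e∉ABC (suc (suc zero))

  opaque
    avoid₂ : ∀ {F A B} → Closed F → Closed A → Closed B → Outside F A → Outside F B →
             ∃ λ e → e ∈ F × e ∉ A × e ∉ B
    avoid₂ F-closed A-closed B-closed F⊈A F⊈B
      with e , e∈F , e∉A , e∉B , _ ← avoid F-closed A-closed B-closed B-closed F⊈A F⊈B F⊈B
      = e , e∈F , e∉A , e∉B

-- Majority colours

data AllButOne {A : Set} (a b c d : A) : Set where
  but-1 : b ≡ c → c ≡ d → AllButOne a b c d
  but-2 : a ≡ c → c ≡ d → AllButOne a b c d
  but-3 : a ≡ b → b ≡ d → AllButOne a b c d
  but-4 : a ≡ b → b ≡ c → AllButOne a b c d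

recolour : ∀ {A : Set} {a b c d a' b' c' d' : A} → a ≡ a' → b ≡ b' → c ≡ c' → d ≡ d' →
           AllButOne a b c d → AllButOne a' b' c' d'
recolour refl refl refl refl abo = abo

module Colouring {n m : ℕ} (M : Matroid n) (loopless : ∀ e → 1 ≤ r M ⁅ e ⁆)
                 (modular : Modular M)
                 (line-thick : ∀ {L} → Lines.Closed M loopless L → r M L ≡ 2 →
                               ModularGeometry.Thick M loopless modular L)
                 (c : Fin n → Fin m) where

  open ThickLines M loopless modular line-thick public

  Coloured : Subset n → Subset n → Fin m → Set
  Coloured X G a = ∀ x → x ∈ X → x ∉ G → c x ≡ a

  -- `G` holds the exceptions. It is not determined by `X`, but for a flat `X` the colour is, by
  -- `agree`.
  Majority : Subset n → Fin m → Set
  Majority X a = ∃ λ G → Closed G × G ⊆ X × rk G < rk X × Coloured X G a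

  opaque
    -- Decidability allows a majority colour to be found by contradiction, as in `two-equal` and
    -- `step`.
    majority? : ∀ X → Dec (∃ (Majority X))
    majority? X = any? λ a → anySubset? λ G →
      (cl G ⊆? G) ×-dec (G ⊆? X) ×-dec (rk G <? rk X) ×-dec
      all? (λ x → (x ∈? X) →-dec ¬? (x ∈? G) →-dec (c x Data.Fin.≟ a))

  opaque
    agree : ∀ {X G G' a b} → Closed X → Closed G → Closed G' → Outside X G → Outside X G' →
            Coloured X G a → Coloured X G' b → a ≡ b
    agree X-closed G-closed G'-closed X⊈G X⊈G' col col'
      with x , x∈X , x∉G , x∉G' ← avoid₂ X-closed G-closed G'-closed X⊈G X⊈G'
      = trans (sym (col x x∈X x∉G)) (col' x x∈X x∉G')

  Meet⊆ : Subset n → Subset n → Subset n → Set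
  Meet⊆ A B K = ∀ {y} → y ∈ A → y ∈ B → y ∈ K

  -- By exchange, a common element outside `K` would together with `K` span `e`, and so put `e` into
  -- `H`.
  pencil-∩ : ∀ {K H e} → Closed K → Closed H → K ⊆ H → e ∉ H → Meet⊆ (cl (K ▹ e)) H K
  pencil-∩ {K} {H} K-closed H-closed K⊆H e∉H {y} y∈ y∈H with y ∈? K
  ... | yes y∈K = y∈K
  ... | no y∉K =
    ⊥-elim (e∉H (cl-least H-closed (▹-⊆ K⊆H y∈H) (exchange y∈ (y∉K ∘ K-closed))))

  not-parallel : ∀ {A B K x y} → Closed A → Meet⊆ A B K → x ∈ A → y ∈ B → y ∉ K → y ∉ pt x
  not-parallel A-closed A∩B x∈A y∈B y∉K y∈x = y∉K (A∩B (pt-⊆ A-closed x∈A y∈x) y∈B)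

  one-on-line : ∀ {L G x y} → rk L ≡ 2 → Closed G → rk G < rk L → y ∉ pt x → x ∈ G → y ∉ G
  one-on-line {L} {G} {x} {y} L≡2 G-closed G<L y∉x x∈G y∈G = <⇒≱ G<L (begin
    rk L           ≡⟨ trans L≡2 (sym (rk-line y∉x)) ⟩
    rk (line x y)  ≤⟨ rk-mono (line-⊆ G-closed x∈G y∈G) ⟩
    rk G           ∎)
    where open ℕ.≤-Reasoning

  opaque
    -- The exceptions have rank below two, so at most one of four different points is among them.
    line-colours : ∀ {L a x₁ x₂ x₃ x₄} → rk L ≡ 2 → Majority L a →
                   x₁ ∈ L → x₂ ∈ L → x₃ ∈ L → x₄ ∈ L →
                   x₂ ∉ pt x₁ → x₃ ∉ pt x₁ → x₄ ∉ pt x₁ → x₃ ∉ pt x₂ → x₄ ∉ pt x₂ → x₄ ∉ pt x₃ →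
                   AllButOne (c x₁) (c x₂) (c x₃) (c x₄)
    line-colours {L} {a} {x₁} {x₂} {x₃} {x₄} L≡2 (G , G-closed , _ , G<L , col)
                 x₁∈ x₂∈ x₃∈ x₄∈ x₁₂ x₁₃ x₁₄ x₂₃ x₂₄ x₃₄ = go (x₁ ∈? G) (x₂ ∈? G) (x₃ ∈? G)
      where
      other : ∀ {x y} → x ∈ G → y ∈ L → y ∉ pt x → c y ≡ a
      other x∈G y∈L y∉x = col _ y∈L (one-on-line L≡2 G-closed G<L y∉x x∈G)
      go : Dec (x₁ ∈ G) → Dec (x₂ ∈ G) → Dec (x₃ ∈ G) → AllButOne (c x₁) (c x₂) (c x₃) (c x₄)
      go (yes x₁∈G) _ _ =
        but-1 (trans (other x₁∈G x₂∈ x₁₂) (sym (other x₁∈G x₃∈ x₁₃)))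
              (trans (other x₁∈G x₃∈ x₁₃) (sym (other x₁∈G x₄∈ x₁₄)))
      go (no x₁∉G) (yes x₂∈G) _ =
        but-2 (trans (col _ x₁∈ x₁∉G) (sym (other x₂∈G x₃∈ x₂₃)))
              (trans (other x₂∈G x₃∈ x₂₃) (sym (other x₂∈G x₄∈ x₂₄)))
      go (no x₁∉G) (no x₂∉G) (yes x₃∈G) =
        but-3 (trans (col _ x₁∈ x₁∉G) (sym (col _ x₂∈ x₂∉G)))
              (trans (col _ x₂∈ x₂∉G) (sym (other x₃∈G x₄∈ x₃₄)))
      go (no x₁∉G) (no x₂∉G) (no x₃∉G) =
        but-4 (trans (col _ x₁∈ x₁∉G) (sym (col _ x₂∈ x₂∉G)))
              (trans (col _ x₂∈ x₂∉G) (sym (col _ x₃∈ x₃∉G)))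

  -- The induction step for a flat of rank at least three

  module Step {j : ℕ} {F : Subset n} (F-closed : Closed F) (F≡ : rk F ≡ suc (suc j)) (1≤j : 1 ≤ j)
              (smaller : ∀ {X} → Closed X → 1 ≤ rk X → rk X < rk F → ∃ (Majority X)) where

    -- Rank `suc j` gives the hyperplanes of `F`, marked `hyp` in names; rank `j` gives the flats of
    -- corank two, marked `co`.
    record Sub (k : ℕ) (X : Subset n) : Set where
      field
        closed : Closed X
        ⊆F     : X ⊆ F
        rk≡    : rk X ≡ k
    open Sub

    opaque
      sub-cl : ∀ {k Z} → Z ⊆ F → rk Z ≡ k → Sub k (cl Z)
      sub-cl Z⊆F Z≡k = record
        { closed = cl-closed ; ⊆F = cl-least F-closed Z⊆F ; rk≡ = trans (rk-cl _) Z≡k }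

    opaque
      sub-maj : ∀ {k X} → Sub k X → 1 ≤ k → k ≤ suc j → ∃ (Majority X)
      sub-maj {k} X-sub 1≤k k≤ = smaller (closed X-sub) (subst (1 ≤_) (sym (rk≡ X-sub)) 1≤k)
        (subst (rk _ <_) (sym F≡) (s≤s (subst (_≤ suc j) (sym (rk≡ X-sub)) k≤)))

    opaque
      hyp-maj : ∀ {H} → Sub (suc j) H → ∃ (Majority H)
      hyp-maj H-hyp = sub-maj H-hyp (s≤s z≤n) ≤-refl

    hyp<F : ∀ {H} → Sub (suc j) H → rk H < rk F
    hyp<F H-hyp = ≤-reflexive (trans (cong suc (rk≡ H-hyp)) (sym F≡))

    opaque
      outside-hyp : ∀ {H} → Sub (suc j) H → Outside F H
      outside-hyp = rk-<⇒outside ∘ hyp<F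

    opaque
      outside-co : ∀ {K H} → Sub j K → Sub (suc j) H → Outside H K
      outside-co K-co H-hyp =
        rk-<⇒outside (≤-reflexive (trans (cong suc (rk≡ K-co)) (sym (rk≡ H-hyp))))

    opaque
      exceptions≤j : ∀ {H G} → Sub (suc j) H → rk G < rk H → rk G ≤ j
      exceptions≤j {H} {G} H-hyp G<H = s≤s⁻¹ (subst (rk G <_) (rk≡ H-hyp) G<H)

    hyp-spans : ∀ {H w} → Sub (suc j) H → w ∈ F → w ∉ H → F ⊆ cl (H ▹ w)
    hyp-spans H-hyp w∈F w∉H =
      closed-rk-⊆ cl-closed (cl-least F-closed (▹-⊆ (⊆F H-hyp) w∈F)) (≤-reflexive
        (trans F≡ (sym (trans (rk-cl _)
          (trans (rk-∉cl (w∉H ∘ closed H-hyp)) (cong suc (rk≡ H-hyp)))))))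

    opaque
      pencil : ∀ {K e} → Sub j K → e ∈ F → e ∉ K → Sub (suc j) (cl (K ▹ e))
      pencil K-co e∈F e∉K = sub-cl (▹-⊆ (⊆F K-co) e∈F)
        (trans (rk-∉cl (e∉K ∘ closed K-co)) (cong suc (rk≡ K-co)))

    opaque
      -- If some element of `K` were not an exception of `H`, the colours would agree. So the
      -- exceptions of `H` contain `K`, and having rank at most `j` they coincide with it.
      deviating : ∀ {K H a b} → Sub j K → Sub (suc j) H → K ⊆ H →
                  Majority K a → Majority H b → a ≢ b → Coloured H K b
      deviating {K} K-co H-hyp K⊆H (_ , GK-closed , _ , GK<K , colK) (G , G-closed , G⊆H , G<H , colH) a≢b
        with ⊆-or-outside K G
      ... | inj₂ K⊈G = ⊥-elim (a≢b (agree (closed K-co) GK-closed G-closed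
              (rk-<⇒outside GK<K) K⊈G colK (λ x x∈K → colH x (K⊆H x∈K))))
      ... | inj₁ K⊆G = λ x x∈H x∉K → colH x x∈H λ x∈G → x∉K
              (closed-rk-⊆ (closed K-co) K⊆G
                (subst (rk G ≤_) (sym (rk≡ K-co)) (exceptions≤j H-hyp G<H)) x∈G)

    -- A hyperplane through `K` of colour `d ≢ a` has no exceptions off `K`, so its majority
    -- determines the colour of `x` itself.
    majority-off : ∀ {K H₀ a d} → Sub j K → Majority K a → Closed H₀ → H₀ ⊆ F → rk H₀ < rk F →
                   K ⊆ H₀ → d ≢ a →
                   (∀ x → x ∈ F → x ∉ H₀ → c x ≡ d ⊎ Majority (cl (K ▹ x)) d) → Majority F d
    majority-off {K} {H₀} {a} {d} K-co majK H₀-closed H₀⊆F H₀<F K⊆H₀ d≢a off =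
      H₀ , H₀-closed , H₀⊆F , H₀<F , col
      where
      col : Coloured F H₀ d
      col x x∈F x∉H₀ with off x x∈F x∉H₀
      ... | inj₁ cx≡d = cx≡d
      ... | inj₂ maj = deviating K-co (pencil K-co x∈F (x∉H₀ ∘ K⊆H₀)) (⊆cl ∘ ⊆▹) majK maj
              (d≢a ∘ sym) x (⊆cl (∈▹ {X = K})) (x∉H₀ ∘ K⊆H₀)

    opaque
      -- The cone over `G` with apex `z` has rank at most that of `H₂`, but contains `z`, which is
      -- not in `H₂`.
      projection-proper : ∀ {K H₁ H₂ G z} → Sub (suc j) H₂ → Meet⊆ H₁ H₂ K → z ∈ H₁ → z ∉ K →
                          rk G ≤ j → Outside H₂ (cl (G ▹ z))
      projection-proper {K} {H₁} {H₂} {G} {z} hyp₂ H₁₂ z∈H₁ z∉K G≤j = ⊈⇒outside λ H₂⊆ →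
        z∉K (H₁₂ z∈H₁ (closed-rk-⊆ (closed hyp₂) H₂⊆ (begin
          rk (cl (G ▹ z))  ≡⟨ rk-cl _ ⟩
          rk (G ▹ z)       ≤⟨ rk-▹ G z ⟩
          suc (rk G)       ≤⟨ s≤s G≤j ⟩
          suc j            ≡⟨ sym (rk≡ hyp₂) ⟩
          rk H₂            ∎) (⊆cl (∈▹ {X = G}))))
        where open ℕ.≤-Reasoning

    opaque
      -- The line `zw` meets the hyperplane `H` in `u`. As `w` avoids the cone over the exceptions
      -- `G` with apex `z`, the element `u` is not an exception.
      projected : ∀ {K H₁ H₂ H G d z w} → Sub (suc j) H₁ → Sub (suc j) H₂ → Sub (suc j) H → K ⊆ H₁ →
                  Meet⊆ H₁ H₂ K → Meet⊆ H₁ H K → Meet⊆ H₂ H K → Coloured H G d →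
                  z ∈ H₁ → z ∉ K → w ∈ H₂ → w ∉ K → w ∉ cl (G ▹ z) →
                  ∃ λ u → u ∈ line z w × u ∈ H × u ∉ K × c u ≡ d
      projected {K} {H₁} {H₂} {H} {G} {d} {z} {w} hyp₁ hyp₂ hyp K⊆H₁ H₁₂ H₁∩H H₂∩H col
                z∈H₁ z∉K w∈H₂ w∉K w∉Gz =
        let u , u∈H , u∈zw = line-meets (closed hyp)
              (hyp-spans hyp (⊆F hyp₂ w∈H₂) (w∉K ∘ H₂∩H w∈H₂) (⊆F hyp₁ z∈H₁))
              (not-parallel (closed hyp₁) H₁₂ z∈H₁ w∈H₂ w∉K)
        in u , u∈zw , u∈H , u∉K u∈H u∈zw , col u u∈H (u∉G u∈H u∈zw)
        where
        u∉z : ∀ {u} → u ∈ H → u ∉ pt z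
        u∉z u∈H u∈z = z∉K (H₁∩H z∈H₁ (pt-⊆ (closed hyp) u∈H (pt-sym u∈z)))
        u∉K : ∀ {u} → u ∈ H → u ∈ line z w → u ∉ K
        u∉K u∈H u∈zw u∈K = w∉K (H₁₂ (line-extend (closed hyp₁) z∈H₁ (K⊆H₁ u∈K) u∈zw (u∉z u∈H)) w∈H₂)
        u∉G : ∀ {u} → u ∈ H → u ∈ line z w → u ∉ G
        u∉G u∈H u∈zw u∈G =
          w∉Gz (line-extend cl-closed (⊆cl (∈▹ {X = G})) (⊆cl (⊆▹ u∈G)) u∈zw (u∉z u∈H))

    -- A generic line through z ∈ H₁ and w ∈ H₂ shows the four colours.
    opaque
      pencil-colours : ∀ {K H₁ H₂ H₃ H₄ b₁ b₂ d₃ d₄} → Sub j K →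
        Sub (suc j) H₁ → Sub (suc j) H₂ → Sub (suc j) H₃ → Sub (suc j) H₄ →
        K ⊆ H₁ → Meet⊆ H₁ H₂ K → Meet⊆ H₁ H₃ K → Meet⊆ H₁ H₄ K →
        Meet⊆ H₂ H₃ K → Meet⊆ H₂ H₄ K → Meet⊆ H₃ H₄ K →
        Coloured H₁ K b₁ → Coloured H₂ K b₂ → Majority H₃ d₃ → Majority H₄ d₄ →
        AllButOne b₁ b₂ d₃ d₄
      pencil-colours {K} {H₁} {H₂} {H₃} {H₄} {b₁} {b₂} {d₃} {d₄} K-co hyp₁ hyp₂ hyp₃ hyp₄
        K⊆H₁ H₁₂ H₁₃ H₁₄ H₂₃ H₂₄ H₃₄
        col₁ col₂ (G₃ , G₃-closed , G₃⊆H₃ , G₃<H₃ , col₃) (G₄ , G₄-closed , G₄⊆H₄ , G₄<H₄ , col₄) =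
        let z , z∈H₁ , z∉K = outside-co K-co hyp₁
            w , w∈H₂ , w∉K , w∉₃ , w∉₄ = avoid (closed hyp₂) (closed K-co) cl-closed cl-closed
              (outside-co K-co hyp₂)
              (projection-proper hyp₂ H₁₂ z∈H₁ z∉K (exceptions≤j hyp₃ G₃<H₃))
              (projection-proper hyp₂ H₁₂ z∈H₁ z∉K (exceptions≤j hyp₄ G₄<H₄))
            u₃ , u₃∈ , u₃∈H₃ , u₃∉K , cu₃ =
              projected hyp₁ hyp₂ hyp₃ K⊆H₁ H₁₂ H₁₃ H₂₃ col₃ z∈H₁ z∉K w∈H₂ w∉K w∉₃
            u₄ , u₄∈ , u₄∈H₄ , u₄∉K , cu₄ =
              projected hyp₁ hyp₂ hyp₄ K⊆H₁ H₁₂ H₁₄ H₂₄ col₄ z∈H₁ z∉K w∈H₂ w∉K w∉₄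
            w∉z = not-parallel (closed hyp₁) H₁₂ z∈H₁ w∈H₂ w∉K
            -- Here `1 ≤ j` matters: it makes the line a proper subflat of `F`, to which the
            -- induction hypothesis applies.
            _ , maj = sub-maj
              (record { closed = cl-closed ; rk≡ = rk-line w∉z
                      ; ⊆F = line-⊆ F-closed (⊆F hyp₁ z∈H₁) (⊆F hyp₂ w∈H₂) })
              (s≤s z≤n) (s≤s 1≤j)
        in recolour (col₁ z z∈H₁ z∉K) (col₂ w w∈H₂ w∉K) cu₃ cu₄
             (line-colours (rk-line w∉z) maj ∈lineˡ ∈lineʳ u₃∈ u₄∈ w∉z
               (not-parallel (closed hyp₁) H₁₃ z∈H₁ u₃∈H₃ u₃∉K)
               (not-parallel (closed hyp₁) H₁₄ z∈H₁ u₄∈H₄ u₄∉K)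
               (not-parallel (closed hyp₂) H₂₃ w∈H₂ u₃∈H₃ u₃∉K)
               (not-parallel (closed hyp₂) H₂₄ w∈H₂ u₄∈H₄ u₄∉K)
               (not-parallel (closed hyp₃) H₃₄ u₃∈H₃ u₄∈H₄ u₄∉K))

    meet-sym : ∀ {A B K} → Meet⊆ A B K → Meet⊆ B A K
    meet-sym A∩B y∈B y∈A = A∩B y∈A y∈B

    -- Two hyperplanes deviating from the same flat of corank two

    module TwoDeviating {K a} (K-co : Sub j K) (majK : Majority K a) where

      record Deviating (H : Subset n) (b : Fin m) : Set where
        field
          hyp : Sub (suc j) H
          K⊆  : K ⊆ H
          col : Coloured H K b
          b≢a : b ≢ a
      open Deviating

      opaque
        fourth : ∀ {H₁ H₂ b₁ b₂ e₃ e₄ d₃ d₄} → Deviating H₁ b₁ → Deviating H₂ b₂ → Meet⊆ H₁ H₂ K →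
                 e₃ ∈ F → e₃ ∉ H₁ → e₃ ∉ H₂ → Majority (cl (K ▹ e₃)) d₃ →
                 e₄ ∈ F → e₄ ∉ H₁ → e₄ ∉ H₂ → e₄ ∉ cl (K ▹ e₃) → Majority (cl (K ▹ e₄)) d₄ →
                 AllButOne b₁ b₂ d₃ d₄
        fourth dev₁ dev₂ H₁₂ e₃∈F e₃∉H₁ e₃∉H₂ maj₃ e₄∈F e₄∉H₁ e₄∉H₂ e₄∉H₃ maj₄ =
          pencil-colours K-co (hyp dev₁) (hyp dev₂)
            (pencil K-co e₃∈F (e₃∉H₁ ∘ K⊆ dev₁)) (pencil K-co e₄∈F (e₄∉H₁ ∘ K⊆ dev₁))
            (K⊆ dev₁) H₁₂ (off dev₁ e₃∉H₁) (off dev₁ e₄∉H₁) (off dev₂ e₃∉H₂) (off dev₂ e₄∉H₂)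
            (meet-sym (pencil-∩ (closed K-co) cl-closed (⊆cl ∘ ⊆▹) e₄∉H₃))
            (col dev₁) (col dev₂) maj₃ maj₄
          where
          off : ∀ {H b e} → Deviating H b → e ∉ H → Meet⊆ H (cl (K ▹ e)) K
          off dev e∉H = meet-sym (pencil-∩ (closed K-co) (closed (hyp dev)) (K⊆ dev) e∉H)

      opaque
        -- Either all hyperplanes through `K` have colour `b`, and the exceptions lie in `K`, or
        -- some `cl (K ▹ e₃)` has another colour. Then `fourth` forces `b` on all the others, and
        -- that hyperplane holds the exceptions.
        two-equal : ∀ {H₁ H₂ b} → Deviating H₁ b → Deviating H₂ b → Meet⊆ H₁ H₂ K → ∃ (Majority F)
        two-equal {H₁} {H₂} {b} dev₁ dev₂ H₁₂ = decidable-stable (majority? F) λ ¬goal →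
          ¬goal (b , majority-off K-co majK (closed K-co) (⊆F K-co)
            (ℕ.<-trans (≤-reflexive (trans (cong suc (rk≡ K-co)) (sym (rk≡ (hyp dev₁))))) (hyp<F (hyp dev₁)))
            id (b≢a dev₁) (λ x x∈F x∉K → case x ∈? H₁ of λ where
              (yes x∈H₁) → inj₁ (col dev₁ x x∈H₁ x∉K)
              (no x∉H₁) → case x ∈? H₂ of λ where
                (yes x∈H₂) → inj₁ (col dev₂ x x∈H₂ x∉K)
                (no x∉H₂) → case hyp-maj (pencil K-co x∈F x∉K) of λ where
                  (d , maj) → case d Data.Fin.≟ b of λ where
                    (yes refl) → inj₂ maj
                    (no d≢b) → ⊥-elim (¬goal (b , exceptional x∈F x∉H₁ x∉H₂ maj d≢b))))
          where
          exceptional : ∀ {e₃ d₃} → e₃ ∈ F → e₃ ∉ H₁ → e₃ ∉ H₂ → Majority (cl (K ▹ e₃)) d₃ →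
                        d₃ ≢ b → Majority F b
          exceptional {e₃} {d₃} e₃∈F e₃∉H₁ e₃∉H₂ maj₃ d₃≢b =
            majority-off K-co majK cl-closed (⊆F hyp₃) (hyp<F hyp₃) (⊆cl ∘ ⊆▹) (b≢a dev₁) off
            where
            hyp₃ : Sub (suc j) (cl (K ▹ e₃))
            hyp₃ = pencil K-co e₃∈F (e₃∉H₁ ∘ K⊆ dev₁)
            off : ∀ x → x ∈ F → x ∉ cl (K ▹ e₃) → c x ≡ b ⊎ Majority (cl (K ▹ x)) b
            off x x∈F x∉H₃ with x ∈? H₁ | x ∈? H₂
            ... | yes x∈H₁ | _ = inj₁ (col dev₁ x x∈H₁ (x∉H₃ ∘ ⊆cl ∘ ⊆▹))
            ... | no _ | yes x∈H₂ = inj₁ (col dev₂ x x∈H₂ (x∉H₃ ∘ ⊆cl ∘ ⊆▹))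
            ... | no x∉H₁ | no x∉H₂ with hyp-maj (pencil K-co x∈F (x∉H₁ ∘ K⊆ dev₁))
            ... | d , maj with fourth dev₁ dev₂ H₁₂ e₃∈F e₃∉H₁ e₃∉H₂ maj₃ x∈F x∉H₁ x∉H₂ x∉H₃ maj
            ... | but-1 b≡d₃ _ = ⊥-elim (d₃≢b (sym b≡d₃))
            ... | but-2 b≡d₃ _ = ⊥-elim (d₃≢b (sym b≡d₃))
            ... | but-3 _ refl = inj₂ maj
            ... | but-4 _ b≡d₃ = ⊥-elim (d₃≢b (sym b≡d₃))

      opaque
        -- Among the colours `b₁`, `b₂`, `b₁` and that of any further hyperplane, only `b₂` can be
        -- the odd one, so the exceptions lie in `H₂`.
        two-different : ∀ {H₁ H₂ b₁ b₂ e₃} → Deviating H₁ b₁ → Deviating H₂ b₂ → Meet⊆ H₁ H₂ K →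
                        b₁ ≢ b₂ → e₃ ∈ F → e₃ ∉ H₁ → e₃ ∉ H₂ → Majority (cl (K ▹ e₃)) b₁ → Majority F b₁
        two-different {H₁} {H₂} {b₁} {b₂} {e₃} dev₁ dev₂ H₁₂ b₁≢b₂ e₃∈F e₃∉H₁ e₃∉H₂ maj₃ =
          majority-off K-co majK (closed (hyp dev₂)) (⊆F (hyp dev₂)) (hyp<F (hyp dev₂)) (K⊆ dev₂)
            (b≢a dev₁) off
          where
          off : ∀ x → x ∈ F → x ∉ H₂ → c x ≡ b₁ ⊎ Majority (cl (K ▹ x)) b₁
          off x x∈F x∉H₂ with x ∈? H₁ | x ∈? cl (K ▹ e₃)
          ... | yes x∈H₁ | _ = inj₁ (col dev₁ x x∈H₁ (x∉H₂ ∘ K⊆ dev₂))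
          ... | no _ | yes x∈H₃ = inj₁ (deviating K-co (pencil K-co e₃∈F (e₃∉H₁ ∘ K⊆ dev₁))
                  (⊆cl ∘ ⊆▹) majK maj₃ (b≢a dev₁ ∘ sym) x x∈H₃ (x∉H₂ ∘ K⊆ dev₂))
          ... | no x∉H₁ | no x∉H₃ with hyp-maj (pencil K-co x∈F (x∉H₁ ∘ K⊆ dev₁))
          ... | d , maj with fourth dev₁ dev₂ H₁₂ e₃∈F e₃∉H₁ e₃∉H₂ maj₃ x∈F x∉H₁ x∉H₂ x∉H₃ maj
          ... | but-1 b₂≡b₁ _ = ⊥-elim (b₁≢b₂ (sym b₂≡b₁))
          ... | but-2 _ refl = inj₂ maj
          ... | but-3 b₁≡b₂ _ = ⊥-elim (b₁≢b₂ b₁≡b₂)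
          ... | but-4 b₁≡b₂ _ = ⊥-elim (b₁≢b₂ b₁≡b₂)

      opaque
        -- When `b₁` and `b₂` differ, two further hyperplanes decide between them: three of the four
        -- colours agree, so the third hyperplane has colour `b₁` or `b₂`.
        two-deviating : ∀ {H₁ H₂ b₁ b₂} → Deviating H₁ b₁ → Deviating H₂ b₂ → Meet⊆ H₁ H₂ K →
                        ∃ (Majority F)
        two-deviating {H₁} {H₂} {b₁} {b₂} dev₁ dev₂ H₁₂ with b₁ Data.Fin.≟ b₂
        ... | yes refl = two-equal dev₁ dev₂ H₁₂
        ... | no b₁≢b₂ with avoid₂ F-closed (closed (hyp dev₁)) (closed (hyp dev₂))
                              (outside-hyp (hyp dev₁)) (outside-hyp (hyp dev₂))
        ... | e₃ , e₃∈F , e₃∉H₁ , e₃∉H₂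
          with hyp₃ ← pencil K-co e₃∈F (e₃∉H₁ ∘ K⊆ dev₁)
          with avoid F-closed (closed (hyp dev₁)) (closed (hyp dev₂)) (closed hyp₃)
                 (outside-hyp (hyp dev₁)) (outside-hyp (hyp dev₂)) (outside-hyp hyp₃)
        ... | e₄ , e₄∈F , e₄∉H₁ , e₄∉H₂ , e₄∉H₃
          with hyp-maj hyp₃ | hyp-maj (pencil K-co e₄∈F (e₄∉H₁ ∘ K⊆ dev₁))
        ... | d₃ , maj₃ | d₄ , maj₄
          with fourth dev₁ dev₂ H₁₂ e₃∈F e₃∉H₁ e₃∉H₂ maj₃ e₄∈F e₄∉H₁ e₄∉H₂ e₄∉H₃ maj₄
        ... | but-1 refl _ = _ , two-different dev₂ dev₁ (meet-sym H₁₂) (b₁≢b₂ ∘ sym) e₃∈F e₃∉H₂ e₃∉H₁ maj₃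
        ... | but-2 refl _ = _ , two-different dev₁ dev₂ H₁₂ b₁≢b₂ e₃∈F e₃∉H₁ e₃∉H₂ maj₃
        ... | but-3 b₁≡b₂ _ = ⊥-elim (b₁≢b₂ b₁≡b₂)
        ... | but-4 b₁≡b₂ _ = ⊥-elim (b₁≢b₂ b₁≡b₂)

      two-deviating-majorities : ∀ {H₁ H₂ b₁ b₂} → Sub (suc j) H₁ → Sub (suc j) H₂ → K ⊆ H₁ → K ⊆ H₂ →
                       Meet⊆ H₁ H₂ K → Majority H₁ b₁ → Majority H₂ b₂ → b₁ ≢ a → b₂ ≢ a →
                       ∃ (Majority F)
      two-deviating-majorities hyp₁ hyp₂ K⊆H₁ K⊆H₂ H₁₂ maj₁ maj₂ b₁≢a b₂≢a =
        two-deviating (dev hyp₁ K⊆H₁ maj₁ b₁≢a) (dev hyp₂ K⊆H₂ maj₂ b₂≢a) H₁₂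
        where
        dev : ∀ {H b} → Sub (suc j) H → K ⊆ H → Majority H b → b ≢ a → Deviating H b
        dev H-hyp K⊆H maj b≢ = record
          { hyp = H-hyp ; K⊆ = K⊆H ; b≢a = b≢
          ; col = deviating K-co H-hyp K⊆H majK maj (b≢ ∘ sym) }

    -- A single deviating hyperplane

    opaque
      -- If the flat `A ∩ B` lay in neither set of exceptions, it would contain an element off both,
      -- coloured `a` and `b` at once.
      cross : ∀ {A B a b} → Sub (suc j) A → Sub (suc j) B →
              (majA : Majority A a) (majB : Majority B b) → a ≢ b →
              Meet⊆ A B (proj₁ majA) ⊎ Meet⊆ A B (proj₁ majB)
      cross {A} {B} hyp-A hyp-B (G , G-closed , _ , _ , colA) (G' , G'-closed , _ , _ , colB) a≢b =
        go (⊆-or-outside (A ∩ B) G) (⊆-or-outside (A ∩ B) G')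
        where
        go : A ∩ B ⊆ G ⊎ Outside (A ∩ B) G → A ∩ B ⊆ G' ⊎ Outside (A ∩ B) G' →
             Meet⊆ A B G ⊎ Meet⊆ A B G'
        go (inj₁ ⊆G) _ = inj₁ λ y∈A y∈B → ⊆G (∩⁺ y∈A y∈B)
        go (inj₂ _) (inj₁ ⊆G') = inj₂ λ y∈A y∈B → ⊆G' (∩⁺ y∈A y∈B)
        go (inj₂ ⊈G) (inj₂ ⊈G') = ⊥-elim (a≢b
          (agree (∩-closed (closed hyp-A) (closed hyp-B)) G-closed G'-closed ⊈G ⊈G'
            (λ x → colA x ∘ ∩⁻ˡ A B) (λ x → colB x ∘ ∩⁻ʳ A B)))

    opaque
      rk-hyp-∩ : ∀ {A B} → Sub (suc j) A → Sub (suc j) B → j ≤ rk (A ∩ B)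
      rk-hyp-∩ {A} {B} hyp-A hyp-B = ℕ.+-cancelˡ-≤ (suc (suc j)) _ _ (begin
        suc (suc j) + j            ≡⟨ sym (ℕ.+-suc (suc j) j) ⟩
        suc j + suc j              ≡⟨ cong₂ _+_ (sym (rk≡ hyp-A)) (sym (rk≡ hyp-B)) ⟩
        rk A + rk B                ≤⟨ rk-∩ (closed hyp-A) (closed hyp-B) (⊆F hyp-A) (⊆F hyp-B) ⟩
        rk F + rk (A ∩ B)          ≡⟨ cong (_+ rk (A ∩ B)) F≡ ⟩
        suc (suc j) + rk (A ∩ B)   ∎)
        where open ℕ.≤-Reasoning

    opaque
      -- Hyperplanes meet in rank at least `j`, so both traces on `A` fill `G`. Thus `G` lies in
      -- `B₁` and `B₂`, hence in `K`, and equals `K` by rank.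
      same-trace : ∀ {A B₁ B₂ G K} → Sub (suc j) A → Sub (suc j) B₁ → Sub (suc j) B₂ →
                   Closed G → rk G ≤ j → Meet⊆ A B₁ G → Meet⊆ A B₂ G →
                   Meet⊆ B₁ B₂ K → rk K ≤ j → K ⊆ A
      same-trace {A} {B₁} {B₂} {G} {K} hyp-A hyp₁ hyp₂ G-closed G≤j AB₁⊆G AB₂⊆G B₁₂⊆K K≤j =
        ∩⁻ˡ A B₁ ∘ G⊆ hyp₁ AB₁⊆G ∘ K⊆G
        where
        ∩⊆G : ∀ {B} → Meet⊆ A B G → A ∩ B ⊆ G
        ∩⊆G {B} AB⊆G y∈ = AB⊆G (∩⁻ˡ A B y∈) (∩⁻ʳ A B y∈)
        G⊆ : ∀ {B} → Sub (suc j) B → Meet⊆ A B G → G ⊆ A ∩ B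
        G⊆ hyp AB⊆G = closed-rk-⊆ (∩-closed (closed hyp-A) (closed hyp)) (∩⊆G AB⊆G)
          (≤-trans G≤j (rk-hyp-∩ hyp-A hyp))
        K⊆G : K ⊆ G
        K⊆G = closed-rk-⊆ G-closed
          (λ y∈G → B₁₂⊆K (∩⁻ʳ A B₁ (G⊆ hyp₁ AB₁⊆G y∈G)) (∩⁻ʳ A B₂ (G⊆ hyp₂ AB₂⊆G y∈G)))
          (≤-trans K≤j (≤-trans (rk-hyp-∩ hyp-A hyp₁) (rk-mono (∩⊆G AB₁⊆G))))

    record Pencil (k : ℕ) (K H : Subset n) : Set where
      field
        E     : Fin k → Subset n
        hyp   : ∀ i → Sub (suc j) (E i)
        K⊆    : ∀ i → K ⊆ E i
        off   : ∀ i → Meet⊆ (E i) H K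
        apart : ∀ i l → i Data.Fin.< l → Meet⊆ (E i) (E l) K

    opaque
      -- Each new hyperplane is spanned by `K` and an element outside the earlier ones; `avoid`
      -- escapes `H` and two more, which allows a third.
      three-others : ∀ {K H} → Sub j K → Sub (suc j) H → K ⊆ H → Pencil 3 K H
      three-others {K} {H} K-co H-hyp K⊆H =
        let e₁ , e₁∈F , e₁∉H = outside-hyp H-hyp
            hyp₁ = pencil K-co e₁∈F (e₁∉H ∘ K⊆H)
            e₂ , e₂∈F , e₂∉H , e₂∉H₁ = avoid₂ F-closed (closed H-hyp) (closed hyp₁)
              (outside-hyp H-hyp) (outside-hyp hyp₁)
            hyp₂ = pencil K-co e₂∈F (e₂∉H ∘ K⊆H)
            e₃ , e₃∈F , e₃∉H , e₃∉H₁ , e₃∉H₂ = avoid F-closed (closed H-hyp) (closed hyp₁) (closed hyp₂)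
              (outside-hyp H-hyp) (outside-hyp hyp₁) (outside-hyp hyp₂)
            hyp₃ = pencil K-co e₃∈F (e₃∉H ∘ K⊆H)
            off : ∀ {e} → e ∉ H → Meet⊆ (cl (K ▹ e)) H K
            off = pencil-∩ (closed K-co) (closed H-hyp) K⊆H
            apart : ∀ {e e'} → e' ∉ cl (K ▹ e) → Meet⊆ (cl (K ▹ e)) (cl (K ▹ e')) K
            apart e'∉ = meet-sym (pencil-∩ (closed K-co) cl-closed (⊆cl ∘ ⊆▹) e'∉)
        in record
          { E = λ { zero → cl (K ▹ e₁) ; (suc zero) → cl (K ▹ e₂) ; (suc (suc zero)) → cl (K ▹ e₃) }
          ; hyp = λ { zero → hyp₁ ; (suc zero) → hyp₂ ; (suc (suc zero)) → hyp₃ }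
          ; K⊆ = λ { zero → ⊆cl ∘ ⊆▹ ; (suc zero) → ⊆cl ∘ ⊆▹ ; (suc (suc zero)) → ⊆cl ∘ ⊆▹ }
          ; off = λ { zero → off e₁∉H ; (suc zero) → off e₂∉H ; (suc (suc zero)) → off e₃∉H }
          ; apart = λ { zero (suc zero) _ → apart e₂∉H₁
                      ; zero (suc (suc zero)) _ → apart e₃∉H₁
                      ; (suc zero) (suc (suc zero)) _ → apart e₃∉H₂
                      ; (suc zero) (suc zero) (s≤s ())
                      ; (suc (suc zero)) (suc zero) (s≤s ())
                      ; (suc (suc zero)) (suc (suc zero)) (s≤s (s≤s ())) } }

    opaque
      choose-two : (Q : Fin 3 → Set) → (∀ i → Dec (Q i)) → (∀ i l → i Data.Fin.< l → ¬ Q i → Q l) →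
                   ∃ λ (p : Fin 2 → Fin 3) → p zero Data.Fin.< p (suc zero) × (∀ l → Q (p l))
      choose-two Q Q? other = go (Q? zero) (Q? (suc zero))
        where
        two : Fin 3
        two = suc (suc zero)
        go : Dec (Q zero) → Dec (Q (suc zero)) →
             ∃ λ (p : Fin 2 → Fin 3) → p zero Data.Fin.< p (suc zero) × (∀ l → Q (p l))
        go (yes q₀) (yes q₁) = (λ { zero → zero ; (suc _) → suc zero }) , s≤s z≤n ,
                               λ { zero → q₀ ; (suc _) → q₁ }
        go (yes q₀) (no ¬q₁) = (λ { zero → zero ; (suc _) → two }) , s≤s z≤n ,
                               λ { zero → q₀ ; (suc _) → other (suc zero) two (s≤s (s≤s z≤n)) ¬q₁ }
        go (no ¬q₀) _ = (λ { zero → suc zero ; (suc _) → two }) , s≤s (s≤s z≤n) ,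
                        λ { zero → other zero (suc zero) (s≤s z≤n) ¬q₀
                          ; (suc _) → other zero two (s≤s z≤n) ¬q₀ }

    opaque
      -- Two of the three hyperplanes deviating from `K` would give `F` a majority colour, so at
      -- most one deviates.
      two-good : ∀ {K H a} → ¬ ∃ (Majority F) → Sub j K → Majority K a → Pencil 3 K H →
                 ∃ λ (P : Pencil 2 K H) → ∀ i → Majority (Pencil.E P i) a
      two-good {K} {H} {a} ¬goal K-co majK P = build
        (choose-two (λ i → proj₁ (maj i) ≡ a) (λ i → proj₁ (maj i) Data.Fin.≟ a)
          (λ i l i<l i-bad → decidable-stable (proj₁ (maj l) Data.Fin.≟ a) λ l-bad →
            ¬goal (TwoDeviating.two-deviating-majorities K-co majK (hyp i) (hyp l) (K⊆ i) (K⊆ l) (apart i l i<l)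
              (proj₂ (maj i)) (proj₂ (maj l)) i-bad l-bad)))
        where
        open Pencil P
        maj : ∀ i → ∃ (Majority (E i))
        maj i = hyp-maj (hyp i)
        build : (∃ λ (p : Fin 2 → Fin 3) → p zero Data.Fin.< p (suc zero) × (∀ l → proj₁ (maj (p l)) ≡ a)) →
                ∃ λ (P : Pencil 2 K H) → ∀ i → Majority (Pencil.E P i) a
        build (p , p< , good) = record
          { E = E ∘ p ; hyp = hyp ∘ p ; K⊆ = K⊆ ∘ p ; off = off ∘ p
          ; apart = λ { zero (suc zero) _ → apart (p zero) (p (suc zero)) p<
                      ; (suc zero) (suc zero) (s≤s ()) } }
          , λ i → subst (Majority (E (p i))) (good i) (proj₂ (maj (p i)))

    -- The hyperplanes of colour a through K and those of colour b through another
    -- K' ⊆ H meet in flats that are the exceptions of one of the two; with three of the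
    -- former and two of the latter there are too many such flats.
    opaque
      two-pencils : ∀ {K K' H a b} → Sub j K → Sub j K' → Outside K' K → K ⊆ H → K' ⊆ H →
                    (P : Pencil 3 K H) → (∀ i → Majority (Pencil.E P i) a) →
                    (P' : Pencil 2 K' H) → (∀ i → Majority (Pencil.E P' i) b) → ¬ (a ≢ b)
      two-pencils {K} {K'} {H} K-co K'-co (e , e∈K' , e∉K) K⊆H K'⊆H P maj P' maj' a≢b =
        -- Each of the three `P.E i` meets some `P'.E t` within the exceptions of the latter, so two
        -- of them share the same `t`. Then `K` lies in `P'.E t` and in `H`, hence in `K'`, and the
        -- two are equal by rank.
        let i , l , i<l , same = pigeonhole ≤-refl (proj₁ ∘ trace)
            i-trace = proj₂ (trace i)
            l-trace = subst (λ t → Meet⊆ (P.E l) (P'.E t) (G' t)) (sym same) (proj₂ (trace l))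
            t = proj₁ (trace i)
            K⊆E' = same-trace (P'.hyp t) (P.hyp i) (P.hyp l) (proj₁ (proj₂ (maj' t)))
              (G'≤j t) (meet-sym i-trace) (meet-sym l-trace) (P.apart i l i<l)
              (≤-reflexive (rk≡ K-co))
        in e∉K (closed-rk-⊆ (closed K-co) (λ y∈K → P'.off t (K⊆E' y∈K) (K⊆H y∈K))
             (≤-reflexive (trans (rk≡ K'-co) (sym (rk≡ K-co)))) e∈K')
        where
        module P = Pencil P
        module P' = Pencil P'
        G' : Fin 2 → Subset n
        G' t = proj₁ (maj' t)
        G'≤j : ∀ t → rk (G' t) ≤ j
        G'≤j t = exceptions≤j (P'.hyp t) (proj₁ (proj₂ (proj₂ (proj₂ (maj' t)))))
        trace : ∀ i → ∃ λ t → Meet⊆ (P.E i) (P'.E t) (G' t)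
        trace i = decide (cross (P.hyp i) (P'.hyp zero) (maj i) (maj' zero) a≢b)
                         (cross (P.hyp i) (P'.hyp (suc zero)) (maj i) (maj' (suc zero)) a≢b)
          where
          G : Subset n
          G = proj₁ (maj i)
          decide : Meet⊆ (P.E i) (P'.E zero) G ⊎ Meet⊆ (P.E i) (P'.E zero) (G' zero) →
                   Meet⊆ (P.E i) (P'.E (suc zero)) G ⊎ Meet⊆ (P.E i) (P'.E (suc zero)) (G' (suc zero)) →
                   ∃ λ t → Meet⊆ (P.E i) (P'.E t) (G' t)
          decide (inj₂ tr) _ = zero , tr
          decide (inj₁ _) (inj₂ tr) = suc zero , tr
          -- If both traces consisted of exceptions of `P.E i`, then `K'` would lie in `P.E i` and
          -- in `H`, hence in `K`.
          decide (inj₁ tr₀) (inj₁ tr₁) = ⊥-elim (e∉K (P.off i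
            (same-trace (P.hyp i) (P'.hyp zero) (P'.hyp (suc zero)) (proj₁ (proj₂ (maj i)))
              (exceptions≤j (P.hyp i) (proj₁ (proj₂ (proj₂ (proj₂ (maj i))))))
              tr₀ tr₁ (P'.apart zero (suc zero) (s≤s z≤n)) (≤-reflexive (rk≡ K'-co)) e∈K')
            (K'⊆H e∈K')))

    opaque
      -- Choose `K'` in `H` of rank `j` through an element off `K`; its colour is `b`, as `H` has
      -- that colour off `K`. Every other hyperplane through `K` has colour `a`, for otherwise it
      -- and `H` would both deviate. Two hyperplanes through `K'` have colour `b`, against
      -- `two-pencils`.
      no-deviating : ∀ {K H a b} → ¬ ∃ (Majority F) → Sub j K → Sub (suc j) H → K ⊆ H →
                     Majority K a → Majority H b → ¬ (a ≢ b)
      no-deviating {K} {H} {a} {b} ¬goal K-co H-hyp K⊆H majK majH a≢b =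
        let e , e∈H , e∉K = outside-co K-co H-hyp
            Z , pt⊆Z , Z⊆H , Z≡j = intermediate (pt-⊆ (closed H-hyp) e∈H)
              (subst (_≤ j) (sym (rk-pt e)) 1≤j) (subst (j ≤_) (sym (rk≡ H-hyp)) (ℕ.n≤1+n j))
            K'-co = sub-cl (⊆F H-hyp ∘ Z⊆H) Z≡j
            K'⊆H = cl-least (closed H-hyp) Z⊆H
            K'⊈K = e , ⊆cl (pt⊆Z ∈pt) , e∉K
            a' , majK' = sub-maj K'-co 1≤j (ℕ.n≤1+n j)
            G' , G'-closed , _ , G'<K' , col' = majK'
            a'≡b = agree cl-closed G'-closed (closed K-co) (rk-<⇒outside G'<K') K'⊈K col'
              (λ x x∈K' → deviating K-co H-hyp K⊆H majK majH a≢b x (K'⊆H x∈K'))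
            P = three-others K-co H-hyp K⊆H
            P' , maj' = two-good ¬goal K'-co majK' (three-others K'-co H-hyp K'⊆H)
        in two-pencils K-co K'-co K'⊈K K⊆H K'⊆H P (majP P)
             P' (λ i → subst (Majority (Pencil.E P' i)) a'≡b (maj' i)) a≢b
        where
        majP : (P : Pencil 3 K H) → ∀ i → Majority (Pencil.E P i) a
        majP P i = let d , maj = hyp-maj (Pencil.hyp P i) in subst (Majority (Pencil.E P i))
          (decidable-stable (d Data.Fin.≟ a) λ d≢a → ¬goal (TwoDeviating.two-deviating-majorities K-co majK
            (Pencil.hyp P i) H-hyp (Pencil.K⊆ P i) K⊆H (Pencil.off P i) maj majH d≢a (a≢b ∘ sym))) maj

    -- No deviating hyperplane

    opaque
      no-deviating⇒majority :
        (∀ {K H a b} → Sub j K → Sub (suc j) H → K ⊆ H → Majority K a → Majority H b → a ≡ b) →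
        ∃ (Majority F)
      no-deviating⇒majority same-colour = a , go (rk B ≤? suc j)
        where
        some-hyp : ∃ (Sub (suc j))
        some-hyp = let Z , _ , Z⊆F , Z≡ = intermediate {⊥} {F} (⊆-min F)
                         (subst (_≤ suc j) (sym rk-⊥) z≤n) (subst (suc j ≤_) (sym F≡) (ℕ.n≤1+n _))
                   in cl Z , sub-cl Z⊆F Z≡
        H₀ : Subset n
        H₀ = proj₁ some-hyp
        hyp₀ : Sub (suc j) H₀
        hyp₀ = proj₂ some-hyp
        a : Fin m
        a = proj₁ (hyp-maj hyp₀)
        B? : Decidable (λ x → x ∈ F × c x ≢ a)
        B? x = (x ∈? F) ×-dec ¬? (c x Data.Fin.≟ a)
        B : Subset n
        B = ⟦ B? ⟧
        B⊆F : B ⊆ F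
        B⊆F = proj₁ ∘ ∈⟦⟧⁻ B?
        -- `H` and `H₀` contain a common flat of rank `j`, whose colour both share.
        all-a : ∀ {H} → Sub (suc j) H → Majority H a
        all-a {H} H-hyp =
          let Z , _ , Z⊆ , Z≡ = intermediate (⊆-min (H ∩ H₀)) (subst (_≤ j) (sym rk-⊥) z≤n)
                (rk-hyp-∩ H-hyp hyp₀)
              K-co = sub-cl (⊆F H-hyp ∘ ∩⁻ˡ H H₀ ∘ Z⊆) Z≡
              _ , majK = sub-maj K-co 1≤j (ℕ.n≤1+n j)
              b , majH = hyp-maj H-hyp
          in subst (Majority H)
               (trans (sym (same-colour K-co H-hyp (cl-least (closed H-hyp) (∩⁻ˡ H H₀ ∘ Z⊆)) majK majH))
                 (same-colour K-co hyp₀ (cl-least (closed hyp₀) (∩⁻ʳ H H₀ ∘ Z⊆)) majK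
                   (proj₂ (hyp-maj hyp₀)))) majH
        go : Dec (rk B ≤ suc j) → Majority F a
        go (yes B≤) = cl B , cl-closed , cl-least F-closed B⊆F ,
          subst (_< rk F) (sym (rk-cl B)) (subst (rk B <_) (sym F≡) (s≤s B≤)) ,
          λ x x∈F x∉B → decidable-stable (c x Data.Fin.≟ a) λ cx≢a → x∉B (⊆cl (∈⟦⟧⁺ B? (x∈F , cx≢a)))
        -- Otherwise elements of other colours span a hyperplane. All of them are exceptions there,
        -- but exceptions have smaller rank.
        go (no B≰) =
          let Z , _ , Z⊆B , Z≡ = intermediate (⊆-min B) (subst (_≤ suc j) (sym rk-⊥) z≤n)
                (ℕ.<⇒≤ (≰⇒> B≰))
              G , G-closed , _ , G<H , col = all-a (sub-cl (B⊆F ∘ Z⊆B) Z≡)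
              Z⊆G = λ {x} (x∈Z : x ∈ Z) → decidable-stable (x ∈? G) λ x∉G →
                proj₂ (∈⟦⟧⁻ B? (Z⊆B x∈Z)) (col x (⊆cl x∈Z) x∉G)
          in ⊥-elim (<⇒≱ G<H (≤-trans (≤-reflexive (rk-cl Z)) (rk-mono Z⊆G)))

    step : ∃ (Majority F)
    step = decidable-stable (majority? F) λ ¬goal → ¬goal (no-deviating⇒majority
      λ K-co H-hyp K⊆H majK majH → decidable-stable (_ Data.Fin.≟ _)
        (no-deviating ¬goal K-co H-hyp K⊆H majK majH))

  majority : (∀ {F} → Closed F → 1 ≤ rk F → rk F ≤ 2 → ∃ (Majority F)) →
             ∀ {F} → Closed F → 1 ≤ rk F → ∃ (Majority F)
  majority small {F} = go F (<-wellFounded (rk F))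
    where
    go : ∀ F → Acc _<_ (rk F) → Closed F → 1 ≤ rk F → ∃ (Majority F)
    by-rank : ∀ F → Acc _<_ (rk F) → Closed F → 1 ≤ rk F → ∀ k → rk F ≡ k → ∃ (Majority F)
    go F a F-closed 1≤ = by-rank F a F-closed 1≤ (rk F) refl
    by-rank F (acc rs) F-closed 1≤ (suc (suc (suc j))) F≡ =
      Step.step F-closed F≡ (s≤s z≤n) (λ X-closed 1≤X X<F → go _ (rs X<F) X-closed 1≤X)
    by-rank F _ F-closed 1≤ 0 F≡ = small F-closed 1≤ (subst (_≤ 2) (sym F≡) z≤n)
    by-rank F _ F-closed 1≤ 1 F≡ = small F-closed 1≤ (subst (_≤ 2) (sym F≡) (s≤s z≤n))
    by-rank F _ F-closed 1≤ 2 F≡ = small F-closed 1≤ (≤-reflexive F≡)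

-- Chains of flats and reduction to finitely many colours

module _ {n : ℕ} (M : Matroid n) where

  open Closure M

  -- Meet the chain with `T`: an element spanned by `F i ∩ T` is spanned by `F i`, so the traces are
  -- flats of the restriction.
  target-restrict : ∀ {C : Set} {c : Fin n → C} {S T} → T ⊆ S → TargetOn M c S → TargetOn M c T
  target-restrict {S = S} {T} T⊆S (k , F , loops , top , flat , chain , mono₀ , mono) =
    k , (λ i → F i ∩ T) ,
    (λ e → (λ e∈ → ∩⁻ʳ (F zero) T e∈ , proj₂ (proj₁ (loops e) (∩⁻ˡ (F zero) T e∈))) ,
           (λ e∈T e≡0 → ∩⁺ (proj₂ (loops e) (T⊆S e∈T) e≡0) e∈T)) ,
    ⊆-antisym (∩⁻ʳ _ T) (λ e∈T → ∩⁺ (subst (_ ∈_) (sym top) (T⊆S e∈T)) e∈T) ,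
    (λ i → ∩⁻ʳ (F i) T , λ e e∈T e∉ → ≰⇒> λ spanned →
      <⇒≱ (proj₂ (flat i) e (T⊆S e∈T) (λ e∈F → e∉ (∩⁺ e∈F e∈T)))
          (spanned-mono (∩⁻ˡ (F i) T) spanned)) ,
    (λ i e∈ → ∩⁺ (chain i (∩⁻ˡ (F (inject₁ i)) T e∈)) (∩⁻ʳ (F (inject₁ i)) T e∈)) ,
    (λ x y x∈ y∈ → mono₀ x y (∩⁻ˡ (F zero) T x∈) (∩⁻ˡ (F zero) T y∈)) ,
    λ i x y x∈ x∉ y∈ y∉ → mono i x y
      (∩⁻ˡ (F (suc i)) T x∈) (λ x∈F → x∉ (∩⁺ x∈F (∩⁻ʳ (F (suc i)) T x∈)))
      (∩⁻ˡ (F (suc i)) T y∈) (λ y∈F → y∉ (∩⁺ y∈F (∩⁻ʳ (F (suc i)) T y∈)))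

  isLine? : Decidable (IsLine M)
  isLine? L = map′ closed⇒flat flat⇒closed (cl L ⊆? L) ×-dec (rk L ℕ.≟ 2)

module _ {n : ℕ} {C : Set} (c : Fin n → C) (R : Fin n → Fin n → Set) (R? : ∀ x y → Dec (R x y))
         (R⇒≡ : ∀ {x y} → R x y → c x ≡ c y) where

  replace : Fin n → Fin n → Fin n → Fin n
  replace a b z with z Data.Fin.≟ a
  ... | yes _ = b
  ... | no _ = z

  replace-source : ∀ a b → replace a b a ≡ b
  replace-source a b with a Data.Fin.≟ a
  ... | yes _ = refl
  ... | no a≢a = ⊥-elim (a≢a refl)

  replace-target : ∀ a b → replace a b b ≡ b
  replace-target a b with b Data.Fin.≟ a
  ... | yes _ = refl
  ... | no _ = refl

  Refines : (Fin n → Fin n) → Set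
  Refines d = ∀ x y → d x ≡ d y → c x ≡ c y

  merge-refines : ∀ {d u v} → Refines d → c u ≡ c v → Refines (replace (d u) (d v) ∘ d)
  merge-refines {d} {u} {v} refines cu≡cv x y eq with d x Data.Fin.≟ d u | d y Data.Fin.≟ d u
  ... | yes x~u | yes y~u = refines x y (trans x~u (sym y~u))
  ... | yes x~u | no _ = trans (refines x u x~u) (trans cu≡cv (refines v y eq))
  ... | no _ | yes y~u = trans (refines x v eq) (trans (sym cu≡cv) (sym (refines y u y~u)))
  ... | no _ | no _ = refines x y eq

  -- Start with all elements coloured differently, and for each related pair in the list recolour
  -- the class of `u` like that of `v`.
  merge : (ps : List (Fin n × Fin n)) →
          ∃ λ d → (∀ x y → (x , y) ∈ₗ ps → R x y → d x ≡ d y) × Refines d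
  merge [] = id , (λ _ _ ()) , λ _ _ → cong c
  merge ((u , v) ∷ ps) with merge ps | R? u v
  ... | d , joins , refines | no ¬Ruv = d , joins' , refines
    where
    joins' : ∀ x y → (x , y) ∈ₗ ((u , v) ∷ ps) → R x y → d x ≡ d y
    joins' x y (here refl) Ruv = ⊥-elim (¬Ruv Ruv)
    joins' x y (there xy∈) Rxy = joins x y xy∈ Rxy
  ... | d , joins , refines | yes Ruv =
    replace (d u) (d v) ∘ d , joins' , merge-refines refines (R⇒≡ Ruv)
    where
    joins' : ∀ x y → (x , y) ∈ₗ ((u , v) ∷ ps) → R x y →
             replace (d u) (d v) (d x) ≡ replace (d u) (d v) (d y)
    joins' x y (here refl) _ = trans (replace-source (d u) (d v)) (sym (replace-target (d u) (d v)))
    joins' x y (there xy∈) Rxy = cong (replace (d u) (d v)) (joins x y xy∈ Rxy)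

  finite-refinement : ∃ λ (d : Fin n → Fin n) → (∀ x y → R x y → d x ≡ d y) × Refines d
  finite-refinement with merge (cartesianProduct (allFin n) (allFin n))
  ... | d , joins , refines =
    d , (λ x y → joins x y (∈-cartesianProduct⁺ (∈-allFin x) (∈-allFin y))) , refines

-- C need not have decidable equality, so c is replaced by a colouring with colours in
-- Fin n that identifies only what the targets on the lines force to be equal.
module _ {n : ℕ} {C : Set} (M : Matroid n) (c : Fin n → C)
         (line-target : ∀ L → IsLine M L → TargetOn M c L) where

  SameBlock : ∀ {k} → (Fin (suc k) → Subset n) → Fin n → Fin n → Set
  SameBlock F x y = (x ∈ F zero × y ∈ F zero) ⊎
    ∃ λ i → x ∈ F (suc i) × x ∉ F (inject₁ i) × y ∈ F (suc i) × y ∉ F (inject₁ i)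

  -- Depends on the decision about `L`, so that one chain per line is fixed and used in all lemmas
  -- below.
  SameBlockOn : ∀ {L} → Dec (IsLine M L) → Fin n → Fin n → Set
  SameBlockOn (yes p) = SameBlock (proj₁ (proj₂ (line-target _ p)))
  SameBlockOn (no _) _ _ = False

  sameBlock? : ∀ {L} (p : Dec (IsLine M L)) x y → Dec (SameBlockOn p x y)
  sameBlock? (yes p) x y = ((x ∈? F zero) ×-dec (y ∈? F zero)) ⊎-dec
    any? λ i → (x ∈? F (suc i)) ×-dec ¬? (x ∈? F (inject₁ i)) ×-dec
               (y ∈? F (suc i)) ×-dec ¬? (y ∈? F (inject₁ i))
    where F = proj₁ (proj₂ (line-target _ p))
  sameBlock? (no _) _ _ = no λ ()

  sameBlock⇒≡ : ∀ {L} (p : Dec (IsLine M L)) {x y} → SameBlockOn p x y → c x ≡ c y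
  sameBlock⇒≡ (yes p) block with line-target _ p
  ... | k , F , _ , _ , _ , _ , mono₀ , mono = go block
    where
    go : ∀ {x y} → SameBlock F x y → c x ≡ c y
    go (inj₁ (x∈ , y∈)) = mono₀ _ _ x∈ y∈
    go (inj₂ (i , x∈ , x∉ , y∈ , y∉)) = mono i _ _ x∈ x∉ y∈ y∉

  sameBlock⇒target : ∀ {D : Set} {d : Fin n → D} {L} (p : Dec (IsLine M L)) →
                     (∀ x y → SameBlockOn p x y → d x ≡ d y) → IsLine M L → TargetOn M d L
  sameBlock⇒target (no ¬line) _ line = ⊥-elim (¬line line)
  sameBlock⇒target (yes p) same _ with line-target _ p
  ... | k , F , loops , top , flat , chain , _ =
    k , F , loops , top , flat , chain ,
    (λ x y x∈ y∈ → same x y (inj₁ (x∈ , y∈))) ,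
    λ i x y x∈ x∉ y∈ y∉ → same x y (inj₂ (i , x∈ , x∉ , y∈ , y∉))

  finite-colouring : ∃ λ (d : Fin n → Fin n) → (∀ L → IsLine M L → TargetOn M d L) ×
                                               (∀ x y → d x ≡ d y → c x ≡ c y)
  finite-colouring with finite-refinement c
    (λ x y → ∃ λ L → SameBlockOn (isLine? M L) x y)
    (λ x y → anySubset? λ L → sameBlock? (isLine? M L) x y)
    (λ (L , block) → sameBlock⇒≡ (isLine? M L) block)
  ... | d , joins , refines =
    d , (λ L → sameBlock⇒target (isLine? M L) (λ x y block → joins x y (L , block))) , refines

target-recolour : ∀ {n} {C D : Set} (M : Matroid n) {c : Fin n → C} {d : Fin n → D} {S} →
                  (∀ x y → d x ≡ d y → c x ≡ c y) → TargetOn M d S → TargetOn M c S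
target-recolour M refines (k , F , loops , top , flat , chain , mono₀ , mono) =
  k , F , loops , top , flat , chain ,
  (λ x y x∈ y∈ → refines x y (mono₀ x y x∈ y∈)) ,
  λ i x y x∈ x∉ y∈ y∉ → refines x y (mono i x y x∈ x∉ y∈ y∉)

module Chains {n m : ℕ} (M : Matroid n) (loopless : ∀ e → 1 ≤ r M ⁅ e ⁆)
              (modular : Modular M)
              (line-thick : ∀ {L} → Lines.Closed M loopless L → r M L ≡ 2 →
                            ModularGeometry.Thick M loopless modular L)
              (c : Fin n → Fin m) where

  open Colouring M loopless modular line-thick c public

  -- Walk up the chain to the first step that reaches the rank of `S`. It reaches all of `S`, and
  -- the flat before it holds the exceptions.
  target⇒majority : ∀ {S} → Closed S → 1 ≤ rk S → TargetOn M c S → ∃ (Majority S)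
  target⇒majority {S} S-closed 1≤S (k , F , loops , top , flat , chain , _ , mono) =
    walk k F top flat chain mono (≤-trans (s≤s F₀≤0) 1≤S)
    where
    F₀≤0 : rk (F zero) ≤ 0
    F₀≤0 = ≤-trans (rk-mono λ e∈ → ⊥-elim
      (ℕ.>⇒≢ (loopless _) (proj₂ (proj₁ (loops _) e∈)))) (≤-reflexive rk-⊥)
    walk : ∀ k (F : Fin (suc k) → Subset n) → F (fromℕ k) ≡ S → (∀ i → IsFlatIn M S (F i)) →
           (∀ i → F (inject₁ i) ⊆ F (suc i)) →
           (∀ i x y → x ∈ F (suc i) → x ∉ F (inject₁ i) → y ∈ F (suc i) → y ∉ F (inject₁ i) → c x ≡ c y) →
           rk (F zero) < rk S → ∃ (Majority S)
    walk zero F top _ _ _ F₀<S = ⊥-elim (ℕ.<-irrefl (cong rk top) F₀<S)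
    walk (suc k) F top flat chain mono F₀<S with rk (F (suc zero)) <? rk S
    ... | yes F₁<S = walk k (F ∘ suc) top (flat ∘ suc) (chain ∘ suc) (mono ∘ suc) F₁<S
    ... | no F₁≮S =
      let e , e∈S , e∉F₀ = rk-<⇒outside F₀<S
      in c e , F zero , F₀-closed , proj₁ (flat zero) , F₀<S ,
         λ x x∈S x∉F₀ → mono zero x e (S⊆F₁ x∈S) x∉F₀ (S⊆F₁ e∈S) e∉F₀
      where
      S⊆F₁ : S ⊆ F (suc zero)
      S⊆F₁ {e} e∈S = decidable-stable (e ∈? F (suc zero)) λ e∉F₁ →
        F₁≮S (≤-trans (proj₂ (flat (suc zero)) e e∈S e∉F₁) (rk-mono (▹-⊆ (proj₁ (flat (suc zero))) e∈S)))
      F₀-closed : Closed (F zero)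
      F₀-closed {e} e∈ = decidable-stable (e ∈? F zero) λ e∉F₀ →
        <⇒≱ (proj₂ (flat zero) e (S-closed (cl-mono (proj₁ (flat zero)) e∈)) e∉F₀) (∈cl⁻ e∈)

  -- The upper part of a chain; the chain is built downwards by removing the flat of exceptions
  -- again and again.
  ChainFrom : Subset n → Set
  ChainFrom G = ∃ λ k → ∃ λ (F : Fin (suc k) → Subset n) →
    F zero ≡ G × F (fromℕ k) ≡ ⊤ × (∀ i → IsFlat M (F i)) × (∀ i → F (inject₁ i) ⊆ F (suc i)) ×
    (∀ i x y → x ∈ F (suc i) → x ∉ F (inject₁ i) → y ∈ F (suc i) → y ∉ F (inject₁ i) → c x ≡ c y)

  extend : ∀ {G G'} → ChainFrom G → Closed G' → G' ⊆ G →
           (∀ x y → x ∈ G → x ∉ G' → y ∈ G → y ∉ G' → c x ≡ c y) → ChainFrom G'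
  extend {G' = G'} (k , F , refl , top , flat , chain , mono) G'-closed G'⊆G mono' =
    suc k , (λ { zero → G' ; (suc i) → F i }) , refl , top ,
    (λ { zero → closed⇒flat G'-closed ; (suc i) → flat i }) ,
    (λ { zero → G'⊆G ; (suc i) → chain i }) ,
    λ { zero → mono' ; (suc i) → mono i }

  majority⇒target : (∀ {F} → Closed F → 1 ≤ rk F → ∃ (Majority F)) → Target M c
  majority⇒target maj = descend ⊤ (<-wellFounded _) (λ _ → ∈⊤)
    (0 , (λ _ → ⊤) , refl , refl , (λ _ → closed⇒flat λ _ → ∈⊤) , (λ ()) , λ ())
    where
    finish : ∀ {G} → rk G ≤ 0 → ChainFrom G → Target M c
    finish {G} G≤0 (k , F , refl , top , flat , chain , mono) =
      k , F ,
      (λ e → (λ e∈G → ⊥-elim (empty e∈G)) , λ _ e≡0 → ⊥-elim (ℕ.>⇒≢ (loopless e) e≡0)) ,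
      top , flat , chain , (λ _ _ x∈G → ⊥-elim (empty x∈G)) , mono
      where
      empty : ∀ {e} → e ∉ G
      empty e∈G = <⇒≱ (loopless _) (≤-trans (rk-mono (⁅⁆⊆ e∈G)) G≤0)
    descend : ∀ G → Acc _<_ (rk G) → Closed G → ChainFrom G → Target M c
    descend G (acc rs) G-closed chain with 1 ≤? rk G
    ... | no 1≰G = finish (s≤s⁻¹ (≰⇒> 1≰G)) chain
    ... | yes 1≤G with maj G-closed 1≤G
    ... | a , G' , G'-closed , G'⊆G , G'<G , col = descend G' (rs G'<G) G'-closed
      (extend chain G'-closed G'⊆G λ x y x∈ x∉ y∈ y∉ → trans (col x x∈ x∉) (sym (col y y∈ y∉)))

  lines⇒target : 2 ≤ rk ⊤ → (∀ L → IsLine M L → TargetOn M c L) → Target M c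
  lines⇒target 2≤ line-target = majority⇒target (majority small)
    where
    -- A flat of rank one or two lies in a line and inherits a target from it.
    small : ∀ {F} → Closed F → 1 ≤ rk F → rk F ≤ 2 → ∃ (Majority F)
    small F-closed 1≤F F≤2 =
      let Z , F⊆Z , _ , Z≡2 = intermediate ⊆⊤ F≤2 2≤
      in target⇒majority F-closed 1≤F (target-restrict M (⊆cl ∘ F⊆Z)
           (line-target (cl Z) (closed⇒flat cl-closed , trans (rk-cl Z) Z≡2)))

-- Loops, the given line, and the theorem

connected⇒loopless : ∀ {n} (M : Matroid n) → Connected M → 2 ≤ r M ⊤ → ∀ e → 1 ≤ r M ⁅ e ⁆
connected⇒loopless M connected 2≤ e = ≰⇒> λ e≤0 →
  -- A loop would be separated from the other elements, of which there is at least one since `M` has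
  -- positive rank.
  let y , _ , y∉e = rk-<⇒outside {⁅ e ⁆} {⊤} (≤-trans (s≤s e≤0) (ℕ.<⇒≤ 2≤))
  in <⇒≱ (connected ⁅ e ⁆ (e , x∈⁅x⁆ e) (y , x∉p⇒x∈∁p y∉e))
         (≤-trans (ℕ.+-monoˡ-≤ (rk (∁ ⁅ e ⁆)) e≤0) (rk-mono ⊆⊤))
  where open Closure M

module _ {n : ℕ} (M : Matroid n) (loopless : ∀ e → 1 ≤ r M ⁅ e ⁆) (modular : Modular M) where

  open ModularGeometry M loopless modular

  point-of : ∀ {P} → IsPoint M P → Nonempty P
  point-of (_ , P≡1) = rk->0⇒nonempty (≤-reflexive (sym P≡1))

  distinct-points : ∀ {P Q x y} → IsPoint M P → IsPoint M Q → P ≢ Q → x ∈ P → y ∈ Q → y ∉ pt x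
  distinct-points {P} {Q} {x} {y} (P-flat , P≡1) (Q-flat , Q≡1) P≢Q x∈P y∈Q y∈x =
    P≢Q (⊆-antisym (pt-⊆ (flat⇒closed Q-flat) (pt-⊆ (flat⇒closed Q-flat) y∈Q (pt-sym y∈x)) ∘ P⊆pt)
                   (pt-⊆ (flat⇒closed P-flat) (pt-⊆ (flat⇒closed P-flat) x∈P y∈x) ∘ Q⊆pt))
    where
    P⊆pt : P ⊆ pt x
    P⊆pt = closed-rk-⊆ cl-closed (pt-⊆ (flat⇒closed P-flat) x∈P)
      (≤-reflexive (trans P≡1 (sym (rk-pt x))))
    Q⊆pt : Q ⊆ pt y
    Q⊆pt = closed-rk-⊆ cl-closed (pt-⊆ (flat⇒closed Q-flat) y∈Q)
      (≤-reflexive (trans Q≡1 (sym (rk-pt y))))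

  four-point-line⇒thick : ∀ {L} → LineWithFourPoints M L → Thick L
  four-point-line⇒thick {L} ((L-flat , L≡2) , P₀ , P₁ , P₂ , P₃ ,
    (pt₀ , P₀⊆L) , (pt₁ , P₁⊆L) , (pt₂ , P₂⊆L) , (pt₃ , P₃⊆L) , ≢₀₁ , ≢₀₂ , ≢₀₃ , ≢₁₂ , ≢₁₃ , ≢₂₃) =
    let x₀ , x₀∈ = point-of pt₀
        x₁ , x₁∈ = point-of pt₁
        x₂ , x₂∈ = point-of pt₂
        x₃ , x₃∈ = point-of pt₃
    in four-points⇒thick (flat⇒closed L-flat) L≡2
      (λ { zero → x₀ ; (suc zero) → x₁ ; (suc (suc zero)) → x₂ ; (suc (suc (suc zero))) → x₃ })
      (λ { zero → P₀⊆L x₀∈ ; (suc zero) → P₁⊆L x₁∈ ; (suc (suc zero)) → P₂⊆L x₂∈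
         ; (suc (suc (suc zero))) → P₃⊆L x₃∈ })
      (λ { zero (suc zero) _ → distinct-points pt₀ pt₁ ≢₀₁ x₀∈ x₁∈
         ; zero (suc (suc zero)) _ → distinct-points pt₀ pt₂ ≢₀₂ x₀∈ x₂∈
         ; zero (suc (suc (suc zero))) _ → distinct-points pt₀ pt₃ ≢₀₃ x₀∈ x₃∈
         ; (suc zero) (suc (suc zero)) _ → distinct-points pt₁ pt₂ ≢₁₂ x₁∈ x₂∈
         ; (suc zero) (suc (suc (suc zero))) _ → distinct-points pt₁ pt₃ ≢₁₃ x₁∈ x₃∈
         ; (suc (suc zero)) (suc (suc (suc zero))) _ → distinct-points pt₂ pt₃ ≢₂₃ x₂∈ x₃∈
         ; (suc zero) (suc zero) (s≤s ())
         ; (suc (suc zero)) (suc zero) (s≤s ())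
         ; (suc (suc (suc zero))) (suc zero) (s≤s ())
         ; (suc (suc zero)) (suc (suc zero)) (s≤s (s≤s ()))
         ; (suc (suc (suc zero))) (suc (suc zero)) (s≤s (s≤s ()))
         ; (suc (suc (suc zero))) (suc (suc (suc zero))) (s≤s (s≤s (s≤s ()))) })

theorem7p9 : ∀ {n : ℕ} {C : Set} (M : Matroid n) (c : Fin n → C) →
    Connected M → Modular M → ∃ (λ L → LineWithFourPoints M L) →
    (Target M c ⇔ (∀ (L : Subset n) → IsLine M L → TargetOn M c L))
theorem7p9 M c connected modular (L₀ , four) = mk⇔
  (λ target L _ → target-restrict M ⊆⊤ target)
  (λ line-target →
    let d , d-lines , refines = finite-colouring M c line-target
    in target-recolour M refines (Chains.lines⇒target M loopless modular line-thick d 2≤ d-lines))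
  where
  2≤ : 2 ≤ r M ⊤
  2≤ = subst (_≤ r M ⊤) (proj₂ (proj₁ four)) (r-mono M ⊆⊤)
  loopless : ∀ e → 1 ≤ r M ⁅ e ⁆
  loopless = connected⇒loopless M connected 2≤
  open ThickGeometry M loopless modular connected
  line-thick : ∀ {L} → Closed L → rk L ≡ 2 → Thick L
  line-thick = thick-lines (flat⇒closed (proj₁ (proj₁ four))) (proj₂ (proj₁ four))
    (four-point-line⇒thick M loopless modular four)
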